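{- Let $k$ and $i$ be integers with $1\le i\le k/2$, $k\equiv 2\pmod 4$ and $i\equiv 1\pmod 4$. Then for all integers $n\ge 0$, $$S_{k,i}(4n+3)\equiv 0\pmod 4.$$
   Context: Write $(a;q)_\infty=\prod_{m\ge 0}(1-aq^m)$, $(a)_\infty=(a;q)_\infty$, and $(a_1,\ldots,a_r;q)_\infty=(a_1;q)_\infty\cdots(a_r;q)_\infty$. For integers $k,i$ with $1\le i\le k/2$, the integers $S_{k,i}(n)$, $n\ge 0$, are given by the generating function $$\sum_{n\ge 0}S_{k,i}(n)q^n=\frac{(-q)_\infty\,(q^i,q^{k-i},q^k;q^k)_\infty}{(q)_\infty}.$$ Combinatorially (an overpartition of $n$ is a partition of $n$ in which the first occurrence of each integer may be overlined): if $i<k/2$, $S_{k,i}(n)$ is the number of overpartitions of $n$ whose non-overlined parts are not congruent to $0,\pm i$ modulo $k$; if $i=k/2$, it is the number of overpartitions of $n$ with no part divisible by $k/2$. -}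

module Defs where

open import Data.Nat.Base as ℕ using (ℕ; zero; suc; _∸_)
open import Data.Integer.Base as ℤ using (ℤ; 0ℤ; 1ℤ)
open import Data.Integer.Properties using (+-*-semiring)
open import Data.Fin.Base using (toℕ)
open import Algebra.Properties.Semiring.Sum +-*-semiring using (sum)

infix  9 _⁻¹
infixr 8 _^_
infix  8 -_
infixl 7 _*_
infixl 6 _-_

-- Formal power series in q over ℤ; f n is the coefficient of qⁿ.
Series : Set
Series = ℕ → ℤ

1# : Series
1# zero    = 1ℤ
1# (suc _) = 0ℤ

q : Series
q 1 = 1ℤ
q _ = 0ℤ

-_ : Series → Series
(- f) n = ℤ.- f n

_-_ : Series → Series → Series
(f - g) n = f n ℤ.- g n

_*_ : Series → Series → Series
(f * g) n = sum {suc n} λ j → f (toℕ j) ℤ.* g (n ∸ toℕ j)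

_^_ : Series → ℕ → Series
f ^ zero  = 1#
f ^ suc n = f * f ^ n

-- The multiplicative inverse of a series with constant term 1 (the only
-- case in which it is used), as the geometric series Σ_{j ≥ 0} (1 - f)^j.
-- Since 1 - f has no constant term, (1 - f)^j does not contribute to the
-- coefficient of qⁿ when j > n.
_⁻¹ : Series → Series
(f ⁻¹) n = sum {suc n} λ j → ((1# - f) ^ toℕ j) n

∏< : ℕ → (ℕ → Series) → Series
∏< zero    f = 1#
∏< (suc N) f = ∏< N f * f N

-- (a; b)∞ = ∏_{m ≥ 0} (1 - a bᵐ), for b without constant term. Then
-- a bᵐ only has terms of degree ≥ m, so the factors with m > n do not
-- affect the coefficient of qⁿ.
⟨_⨾_⟩∞ : Series → Series → Series
⟨ a ⨾ b ⟩∞ n = ∏< (suc n) (λ m → 1# - a * b ^ m) n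

⟨_,_,_⨾_⟩∞ : Series → Series → Series → Series → Series
⟨ a₁ , a₂ , a₃ ⨾ b ⟩∞ = ⟨ a₁ ⨾ b ⟩∞ * ⟨ a₂ ⨾ b ⟩∞ * ⟨ a₃ ⨾ b ⟩∞

-- S k i n is the coefficient of qⁿ in the generating function
-- (-q)∞ (qⁱ, qᵏ⁻ⁱ, qᵏ; qᵏ)∞ / (q)∞; meaningful for 1 ≤ i ≤ k / 2.
S : ℕ → ℕ → ℕ → ℤ
S k i = ⟨ - q ⨾ q ⟩∞ * ⟨ q ^ i , q ^ (k ∸ i) , q ^ k ⨾ q ^ k ⟩∞ * ⟨ q ⨾ q ⟩∞ ⁻¹

{-# OPTIONS --safe #-}

-- Write F(k,i) for the triple product (qⁱ, qᵏ⁻ⁱ, qᵏ; qᵏ)∞, so that S k i has generating function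
-- F(k,i) P with P = (-q)∞ / (q)∞.  By Jacobi's triple product, F(k,i) = Σ ± q^(k m(m-1)/2 + i m), and the
-- exponents are ≡ m² (mod 4) when k ≡ 2 and i ≡ 1 (mod 4); so F(k,i) is supported on the residues 0 and 1.
-- In particular φ = F(2,1) is.  As φ (-q)∞ = (q)∞ we have φ P = 1, and P = 1 + 2g because (-q)∞ ≡ (q)∞ (mod 2);
-- hence P = 2 - φ + 4 φ g² is, modulo 4, supported on the residues 0 and 1 as well, and no residue 3 can
-- occur in F(k,i) P modulo 4.
--
-- Jacobi's identity is used in the truncated form given by Rothe's q-binomial theorem
--   ∏_{s<n} (u - bˢ) = (b)ₙ Σ_{r+s=n} (-1)ˢ b^(s(s-1)/2) uʳ / ((b)ᵣ (b)ₛ)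
-- with n = 2N+1, b = qᵏ, u = q^(kN+k-i): multiplied by (b)_N, each summand is a signed monomial times a
-- series that agrees with 1 up to high order.

module Submission where

open import Algebra.Bundles using (CommutativeRing)
import Algebra.Construct.Pointwise as Pointwise
import Algebra.Solver.Ring as RingSolver
open import Algebra.Solver.Ring.AlmostCommutativeRing using (_-Raw-AlmostCommutative⟶_; fromCommutativeRing)
open import Data.Empty using (⊥-elim)
open import Data.Fin using (toℕ; fromℕ; inject₁)
import Data.Fin.Properties as Fin
open import Data.Integer as ℤ using (ℤ; +_; -[1+_]; _⊖_; 0ℤ; 1ℤ)
open import Data.Integer.Divisibility.Signed using (_∣_; divides)
import Data.Integer.Properties as ℤ
import Algebra.Properties.Semiring.Sum ℤ.+-*-semiring as ℤSum
open import Data.Integer.Solver using (module +-*-Solver)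
open import Data.Maybe.Base using (Maybe; just; nothing)
open import Data.Nat using (ℕ; zero; suc; s≤s; z≤n; _≤_; _<_; NonZero; _%_)
import Data.Nat as ℕ
import Data.Nat.DivMod as ℕ
import Data.Nat.Properties as ℕ
open import Data.Product using (_,_)
open import Data.Sum using (inj₁; inj₂; [_,_]′)
import Defs as D
open D using (Series; q; ∏<; ⟨_⨾_⟩∞; ⟨_,_,_⨾_⟩∞; _⁻¹)
open import Function using (_∘_)
open import Level using (0ℓ)
open import Relation.Binary.PropositionalEquality as ≡ using (_≡_; cong; cong₂; subst)
open import Relation.Nullary using (yes; no)


-- A ring solver with integer coefficients, so that opposite terms cancel

module IntegerCoefficients {a ℓ} (R : CommutativeRing a ℓ) where
  open CommutativeRing R
  open import Algebra.Properties.Ring ring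
  open import Algebra.Properties.AbelianGroup +-abelianGroup
  open import Algebra.Properties.Monoid.Mult.TCOptimised +-monoid using (1+×; ×-homo-+) renaming (_×_ to infixl 8 _×_)
  open import Algebra.Properties.Semiring.Mult.TCOptimised semiring using (×1-homo-*)
  open import Algebra.Properties.CommutativeSemigroup +-commutativeSemigroup using (interchange)
  open import Relation.Binary.Reasoning.Setoid setoid

  -- The multiple `×` is the variant with `1 × x` equal to `x` by definition, so `con 1ℤ` in a
  -- solver call denotes `1#` itself.
  embed : ℤ → Carrier
  embed (+ n)    = n × 1#
  embed -[1+ n ] = - (suc n × 1#)

  embed-⊖ : ∀ m n → embed (m ⊖ n) ≈ m × 1# - n × 1#
  embed-⊖ m       zero    = sym (trans (+-congˡ -0#≈0#) (+-identityʳ _))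
  embed-⊖ zero    (suc n) = sym (+-identityˡ _)
  embed-⊖ (suc m) (suc n) = begin
    embed (suc m ⊖ suc n)                 ≡⟨ ≡.cong embed (ℤ.[1+m]⊖[1+n]≡m⊖n m n) ⟩
    embed (m ⊖ n)                         ≈⟨ embed-⊖ m n ⟩
    m × 1# - n × 1#                       ≈⟨ +-identityˡ _ ⟨
    0# + (m × 1# - n × 1#)                ≈⟨ +-congʳ (-‿inverseʳ 1#) ⟨
    (1# - 1#) + (m × 1# - n × 1#)         ≈⟨ interchange 1# (- 1#) (m × 1#) (- (n × 1#)) ⟩
    (1# + m × 1#) + (- 1# - n × 1#)       ≈⟨ +-congˡ (⁻¹-∙-comm 1# (n × 1#)) ⟩
    (1# + m × 1#) - (1# + n × 1#)         ≈⟨ +-cong (1+× m 1#) (-‿cong (1+× n 1#)) ⟨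
    suc m × 1# - suc n × 1#               ∎

  embed-neg : ∀ x → embed (ℤ.- x) ≈ - embed x
  embed-neg (+ zero)     = sym -0#≈0#
  embed-neg (+ (suc n))  = refl
  embed-neg -[1+ n ]     = sym (⁻¹-involutive _)

  embed-+ : ∀ x y → embed (x ℤ.+ y) ≈ embed x + embed y
  embed-+ (+ m)    (+ n)    = ×-homo-+ 1# m n
  embed-+ (+ m)    -[1+ n ] = embed-⊖ m (suc n)
  embed-+ -[1+ m ] (+ n)    = trans (embed-⊖ n (suc m)) (+-comm _ _)
  embed-+ -[1+ m ] -[1+ n ] = begin
    - (suc (suc (m ℕ.+ n)) × 1#)        ≡⟨ ≡.cong (λ k → - (suc k × 1#)) (ℕ.+-suc m n) ⟨
    - ((suc m ℕ.+ suc n) × 1#)          ≈⟨ -‿cong (×-homo-+ 1# (suc m) (suc n)) ⟩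
    - (suc m × 1# + suc n × 1#)         ≈⟨ ⁻¹-∙-comm _ _ ⟨
    - (suc m × 1#) - (suc n × 1#)       ∎

  embed-+*+ : ∀ m n → embed (+ m ℤ.* + n) ≈ embed (+ m) * embed (+ n)
  embed-+*+ m n = begin
    embed (+ m ℤ.* + n)   ≡⟨ ≡.cong embed (ℤ.pos-* m n) ⟨
    (m ℕ.* n) × 1#        ≈⟨ ×1-homo-* m n ⟩
    m × 1# * (n × 1#)     ∎

  embed-neg* : ∀ x y → embed (x ℤ.* y) ≈ embed x * embed y → embed (ℤ.- x ℤ.* y) ≈ embed (ℤ.- x) * embed y
  embed-neg* x y eq = begin
    embed (ℤ.- x ℤ.* y)         ≡⟨ ≡.cong embed (ℤ.neg-distribˡ-* x y) ⟨
    embed (ℤ.- (x ℤ.* y))       ≈⟨ embed-neg (x ℤ.* y) ⟩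
    - embed (x ℤ.* y)           ≈⟨ -‿cong eq ⟩
    - (embed x * embed y)       ≈⟨ -‿distribˡ-* _ _ ⟩
    - embed x * embed y         ≈⟨ *-congʳ (embed-neg x) ⟨
    embed (ℤ.- x) * embed y     ∎

  embed-* : ∀ x y → embed (x ℤ.* y) ≈ embed x * embed y
  embed-*+ : ∀ x n → embed (x ℤ.* + n) ≈ embed x * embed (+ n)
  embed-*+ (+ m) n    = embed-+*+ m n
  embed-*+ -[1+ m ] n = embed-neg* (+ suc m) (+ n) (embed-+*+ (suc m) n)
  embed-* x (+ n)    = embed-*+ x n
  embed-* x -[1+ n ] = begin
    embed (x ℤ.* -[1+ n ])        ≡⟨ ≡.cong embed (ℤ.*-comm x -[1+ n ]) ⟩
    embed (-[1+ n ] ℤ.* x)        ≈⟨ embed-neg* (+ suc n) x flipped ⟩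
    embed -[1+ n ] * embed x      ≈⟨ *-comm _ _ ⟩
    embed x * embed -[1+ n ]      ∎
    where
    flipped : embed (+ suc n ℤ.* x) ≈ embed (+ suc n) * embed x
    flipped = begin
      embed (+ suc n ℤ.* x)           ≡⟨ ≡.cong embed (ℤ.*-comm (+ suc n) x) ⟩
      embed (x ℤ.* + suc n)           ≈⟨ embed-*+ x (suc n) ⟩
      embed x * embed (+ suc n)       ≈⟨ *-comm _ _ ⟩
      embed (+ suc n) * embed x       ∎

  embedding : CommutativeRing.rawRing ℤ.+-*-commutativeRing -Raw-AlmostCommutative⟶ fromCommutativeRing R
  embedding = record
    { ⟦_⟧    = embed
    ; +-homo = embed-+
    ; *-homo = embed-*
    ; -‿homo = embed-neg
    ; 0-homo = refl
    ; 1-homo = refl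
    }

  embed≟ : ∀ x y → Maybe (embed x ≈ embed y)
  embed≟ x y with x ℤ.≟ y
  ... | yes eq = just (reflexive (≡.cong embed eq))
  ... | no _   = nothing

  open RingSolver (CommutativeRing.rawRing ℤ.+-*-commutativeRing) (fromCommutativeRing R) embedding embed≟ public

-- Finite product identities in a commutative ring

-- The triangular number n(n-1)/2, indexed as in the exponents of Jacobi's series.
triangle : ℕ → ℕ
triangle zero    = 0
triangle (suc n) = triangle n ℕ.+ n

module FiniteProducts {a ℓ} (R : CommutativeRing a ℓ) where
  open CommutativeRing R
  open import Algebra.Properties.CommutativeSemiring.Exp commutativeSemiring
  open import Relation.Binary.Reasoning.Setoid setoid
  open IntegerCoefficients R using (solve; con; _:=_; _:+_; _:*_; _:-_; :-_)

  -- The finite q-Pochhammer symbol (a; b)ₙ.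
  poch : Carrier → Carrier → ℕ → Carrier
  poch a b zero    = 1#
  poch a b (suc n) = poch a b n * (1# - a * b ^ n)

  poch-congˡ : ∀ {a a′} b n → a ≈ a′ → poch a b n ≈ poch a′ b n
  poch-congˡ b zero    eq = refl
  poch-congˡ b (suc n) eq = *-cong (poch-congˡ b n eq) (+-congˡ (-‿cong (*-congʳ eq)))

  square-^ : ∀ b n → (b ^ 2) ^ n ≈ b ^ n * b ^ n
  square-^ b n = begin
    (b ^ 2) ^ n       ≈⟨ ^-congˡ n (*-congˡ (*-identityʳ b)) ⟩
    (b * b) ^ n       ≈⟨ ^-distrib-* b b n ⟩
    b ^ n * b ^ n     ∎

  -- Factor by factor, (1 + x)(1 - x) = 1 - x² at x = b^(n+1).
  poch-neg-* : ∀ b n → poch (- b) b n * poch b b n ≈ poch (b ^ 2) (b ^ 2) n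
  poch-neg-* b zero    = *-identityˡ 1#
  poch-neg-* b (suc n) = begin
    poch (- b) b n * (1# - - b * b ^ n) * (poch b b n * (1# - b * b ^ n))
      ≈⟨ solve 4 (λ x y b c → x :* (con 1ℤ :- (:- b) :* c) :* (y :* (con 1ℤ :- b :* c))
                         := x :* y :* (con 1ℤ :- b :* (b :* con 1ℤ) :* (c :* c)))
               refl (poch (- b) b n) (poch b b n) b (b ^ n) ⟩
    poch (- b) b n * poch b b n * (1# - b ^ 2 * (b ^ n * b ^ n))
      ≈⟨ *-cong (poch-neg-* b n) (+-congˡ (-‿cong (*-congˡ (sym (square-^ b n))))) ⟩
    poch (b ^ 2) (b ^ 2) n * (1# - b ^ 2 * (b ^ 2) ^ n) ∎

  -- The odd and the even powers of b interleave: the step from n to n + 1 adds the exponents 2n + 1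
  -- and 2n + 2.
  poch-odd-* : ∀ b n → poch b (b ^ 2) n * poch (b ^ 2) (b ^ 2) n ≈ poch b b (n ℕ.+ n)
  poch-odd-* b zero    = *-identityˡ 1#
  poch-odd-* b (suc n) = begin
    poch b (b ^ 2) n * (1# - b * (b ^ 2) ^ n) * (poch (b ^ 2) (b ^ 2) n * (1# - b ^ 2 * (b ^ 2) ^ n))
      ≈⟨ solve 4 (λ x y b c → x :* (con 1ℤ :- b :* c) :* (y :* (con 1ℤ :- b :* (b :* con 1ℤ) :* c))
                         := x :* y :* (con 1ℤ :- b :* c) :* (con 1ℤ :- b :* (b :* c)))
               refl (poch b (b ^ 2) n) (poch (b ^ 2) (b ^ 2) n) b ((b ^ 2) ^ n) ⟩
    poch b (b ^ 2) n * poch (b ^ 2) (b ^ 2) n * (1# - b * (b ^ 2) ^ n) * (1# - b * (b * (b ^ 2) ^ n))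
      ≈⟨ *-cong (*-cong (poch-odd-* b n) (+-congˡ (-‿cong (*-congˡ even))))
                (+-congˡ (-‿cong (*-congˡ (*-congˡ even)))) ⟩
    poch b b (suc (suc (n ℕ.+ n)))
      ≡⟨ ≡.cong (λ m → poch b b (suc m)) (ℕ.+-suc n n) ⟨
    poch b b (suc n ℕ.+ suc n) ∎
    where
    even : (b ^ 2) ^ n ≈ b ^ (n ℕ.+ n)
    even = trans (square-^ b n) (sym (^-homo-* b n n))

  -- Carrying both indices of r + s = n avoids truncated subtraction. The recursion splits off the
  -- end s = 0, `antidiagonal-last` the end r = 0.
  antidiagonal : ℕ → (ℕ → ℕ → Carrier) → Carrier
  antidiagonal zero    g = g 0 0
  antidiagonal (suc n) g = g (suc n) 0 + antidiagonal n (λ r s → g r (suc s))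

  antidiagonal-cong : ∀ n {g h : ℕ → ℕ → Carrier} → (∀ r s → r ℕ.+ s ≡ n → g r s ≈ h r s) →
                      antidiagonal n g ≈ antidiagonal n h
  antidiagonal-cong zero    eq = eq 0 0 ≡.refl
  antidiagonal-cong (suc n) eq =
    +-cong (eq (suc n) 0 (ℕ.+-identityʳ (suc n)))
           (antidiagonal-cong n (λ r s e → eq r (suc s) (≡.trans (ℕ.+-suc r s) (≡.cong suc e))))

  antidiagonal-+ : ∀ n g h → antidiagonal n (λ r s → g r s + h r s) ≈ antidiagonal n g + antidiagonal n h
  antidiagonal-+ zero    g h = refl
  antidiagonal-+ (suc n) g h =
    trans (+-congˡ (antidiagonal-+ n (λ r s → g r (suc s)) (λ r s → h r (suc s))))
          (solve 4 (λ a b c d → a :+ b :+ (c :+ d) := a :+ c :+ (b :+ d)) refl _ _ _ _)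

  antidiagonal-* : ∀ n c g → antidiagonal n (λ r s → c * g r s) ≈ c * antidiagonal n g
  antidiagonal-* zero    c g = refl
  antidiagonal-* (suc n) c g =
    trans (+-congˡ (antidiagonal-* n c (λ r s → g r (suc s)))) (sym (distribˡ _ _ _))

  antidiagonal-last : ∀ n g → antidiagonal (suc n) g ≈ antidiagonal n (λ r s → g (suc r) s) + g 0 (suc n)
  antidiagonal-last zero    g = refl
  antidiagonal-last (suc n) g =
    trans (+-congˡ (antidiagonal-last n (λ r s → g r (suc s)))) (sym (+-assoc _ _ _))

  -- The product on the left side of Rothe's theorem.
  falling : Carrier → Carrier → ℕ → Carrier
  falling u b zero    = 1#
  falling u b (suc n) = falling u b n * (u - b ^ n)

  falling-cong : ∀ {u u′} b n → u ≈ u′ → falling u b n ≈ falling u′ b n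
  falling-cong b zero    eq = refl
  falling-cong b (suc n) eq = *-cong (falling-cong b n eq) (+-congʳ eq)

  -- Every factor but the first is divisible by b: b u - b^(s+1) = b (u - b^s).
  falling-head : ∀ u b n → falling (b * u) b (suc n) ≈ (b * u - 1#) * (b ^ n * falling u b n)
  falling-head u b zero    = solve 1 (λ x → con 1ℤ :* (x :- con 1ℤ) := (x :- con 1ℤ) :* (con 1ℤ :* con 1ℤ)) refl (b * u)
  falling-head u b (suc n) = begin
    falling (b * u) b (suc n) * (b * u - b * b ^ n)
      ≈⟨ *-congʳ (falling-head u b n) ⟩
    (b * u - 1#) * (b ^ n * falling u b n) * (b * u - b * b ^ n)
      ≈⟨ solve 4 (λ b u c f → (b :* u :- con 1ℤ) :* (c :* f) :* (b :* u :- b :* c)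
                          := (b :* u :- con 1ℤ) :* (b :* c :* (f :* (u :- c))))
               refl b u (b ^ n) (falling u b n) ⟩
    (b * u - 1#) * (b * b ^ n * (falling u b n * (u - b ^ n))) ∎

  sign : ℕ → Carrier
  sign s = (- 1#) ^ s

  sign-* : ∀ s f → sign (suc s) * f ≈ - (sign s * f)
  sign-* s f = solve 2 (λ x f → (:- con 1ℤ) :* x :* f := :- (x :* f)) refl (sign s) f

  sign-cancel : ∀ s f → sign s * (sign s * f) ≈ f
  sign-cancel zero    f = solve 1 (λ f → con 1ℤ :* (con 1ℤ :* f) := f) refl f
  sign-cancel (suc s) f = trans
    (solve 2 (λ x f → (:- con 1ℤ) :* x :* ((:- con 1ℤ) :* x :* f) := x :* (x :* f)) refl (sign s) f)
    (sign-cancel s f)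

  -- triPower b s = (-1)ˢ b^(s(s-1)/2)
  triPower : Carrier → ℕ → Carrier
  triPower b zero    = 1#
  triPower b (suc s) = - (b ^ s) * triPower b s

  triPower-monomial : ∀ x k s → triPower (x ^ k) s ≈ sign s * x ^ (k ℕ.* triangle s)
  triPower-monomial x k s = trans (triPower-triangle (x ^ k) s) (*-congˡ (^-assocʳ x k (triangle s)))
    where
    triPower-triangle : ∀ b s → triPower b s ≈ sign s * b ^ triangle s
    triPower-triangle b zero    = sym (*-identityˡ 1#)
    triPower-triangle b (suc s) = begin
      - (b ^ s) * triPower b s                          ≈⟨ *-congˡ (triPower-triangle b s) ⟩
      - (b ^ s) * (sign s * b ^ triangle s)
        ≈⟨ solve 3 (λ c x d → (:- c) :* (x :* d) := (:- con 1ℤ) :* x :* (d :* c)) refl (b ^ s) (sign s) (b ^ triangle s) ⟩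
      sign (suc s) * (b ^ triangle s * b ^ s)    ≈⟨ *-congˡ (^-homo-* b (triangle s) s) ⟨
      sign (suc s) * b ^ triangle (suc s)        ∎

  triPower-*-monomial : ∀ x k c s r →
                     triPower (x ^ k) s * (x ^ c) ^ r ≈ sign s * x ^ (k ℕ.* triangle s ℕ.+ c ℕ.* r)
  triPower-*-monomial x k c s r = begin
    triPower (x ^ k) s * (x ^ c) ^ r                             ≈⟨ *-cong (triPower-monomial x k s) (^-assocʳ x c r) ⟩
    sign s * x ^ (k ℕ.* triangle s) * x ^ (c ℕ.* r)       ≈⟨ *-assoc _ _ _ ⟩
    sign s * (x ^ (k ℕ.* triangle s) * x ^ (c ℕ.* r))     ≈⟨ *-congˡ (^-homo-* x (k ℕ.* triangle s) (c ℕ.* r)) ⟨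
    sign s * x ^ (k ℕ.* triangle s ℕ.+ c ℕ.* r)           ∎

  -- For u = b^n y and s ≤ n, u - b^s = -b^s (1 - y b^(n-s)). The monomials multiply to `triPower`,
  -- and the remaining factors are those of (y; b) in reverse order.
  falling-low : ∀ y b n → falling (b ^ n * y) b (suc n) ≈ triPower b (suc n) * poch y b (suc n)
  falling-low y b zero    =
    solve 1 (λ y → con 1ℤ :* (con 1ℤ :* y :- con 1ℤ) := (:- con 1ℤ :* con 1ℤ) :* (con 1ℤ :* (con 1ℤ :- y :* con 1ℤ)))
      refl y
  falling-low y b (suc n) = begin
    falling (b * b ^ n * y) b (suc (suc n))
      ≈⟨ falling-cong b (suc (suc n)) (*-assoc b (b ^ n) y) ⟩
    falling (b * (b ^ n * y)) b (suc (suc n))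
      ≈⟨ falling-head (b ^ n * y) b (suc n) ⟩
    (b * (b ^ n * y) - 1#) * (b ^ suc n * falling (b ^ n * y) b (suc n))
      ≈⟨ *-congˡ (*-congˡ (falling-low y b n)) ⟩
    (b * (b ^ n * y) - 1#) * (b ^ suc n * (triPower b (suc n) * poch y b (suc n)))
      ≈⟨ solve 5 (λ b c y v p → (b :* (c :* y) :- con 1ℤ) :* (b :* c :* (v :* p))
                             := (:- (b :* c)) :* v :* (p :* (con 1ℤ :- y :* (b :* c))))
               refl b (b ^ n) y (triPower b (suc n)) (poch y b (suc n)) ⟩
    triPower b (suc (suc n)) * poch y b (suc (suc n)) ∎

  -- As b^m = u x, the factors beyond the first m are u - b^(m+j) = u (1 - x b^j).
  falling-high : ∀ {x u} b m n → u * x ≈ b ^ m → falling u b (m ℕ.+ n) ≈ falling u b m * (u ^ n * poch x b n)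
  falling-high {x} {u} b m zero    eq = begin
    falling u b (m ℕ.+ 0)          ≡⟨ ≡.cong (falling u b) (ℕ.+-identityʳ m) ⟩
    falling u b m                  ≈⟨ solve 1 (λ x → x := x :* (con 1ℤ :* con 1ℤ)) refl _ ⟩
    falling u b m * (1# * 1#)      ∎
  falling-high {x} {u} b m (suc n) eq = begin
    falling u b (m ℕ.+ suc n)
      ≡⟨ ≡.cong (falling u b) (ℕ.+-suc m n) ⟩
    falling u b (m ℕ.+ n) * (u - b ^ (m ℕ.+ n))
      ≈⟨ *-cong (falling-high b m n eq) (+-congˡ (-‿cong (trans (^-homo-* b m n) (*-congʳ (sym eq))))) ⟩
    falling u b m * (u ^ n * poch x b n) * (u - u * x * b ^ n)
      ≈⟨ solve 6 (λ f c p u x d → f :* (c :* p) :* (u :- u :* x :* d) := f :* (u :* c :* (p :* (con 1ℤ :- x :* d))))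
               refl (falling u b m) (u ^ n) (poch x b n) u x (b ^ n) ⟩
    falling u b m * (u ^ suc n * poch x b (suc n)) ∎

  -- Rothe's q-binomial theorem

  module Rothe (b u : Carrier) (w : ℕ → Carrier) (w-inverse : ∀ n → poch b b n * w n ≈ 1#) where

    -- The function `w` supplies the inverses of (b; b)ₙ, so this is the summand (-1)ˢ b^(s(s-1)/2)
    -- uʳ / ((b)ᵣ (b)ₛ).
    term : ℕ → ℕ → Carrier
    term r s = w r * w s * (triPower b s * u ^ r)

    w-suc : ∀ n → (1# - b ^ suc n) * w (suc n) ≈ w n
    w-suc n = begin
      (1# - b ^ suc n) * w (suc n)
        ≈⟨ *-identityˡ _ ⟨
      1# * ((1# - b ^ suc n) * w (suc n))
        ≈⟨ *-congʳ (w-inverse n) ⟨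
      poch b b n * w n * ((1# - b ^ suc n) * w (suc n))
        ≈⟨ solve 4 (λ p w c w₁ → p :* w :* (c :* w₁) := w :* (p :* c :* w₁)) refl
                 (poch b b n) (w n) (1# - b ^ suc n) (w (suc n)) ⟩
      w n * (poch b b (suc n) * w (suc n))
        ≈⟨ *-congˡ (w-inverse (suc n)) ⟩
      w n * 1#
        ≈⟨ *-identityʳ (w n) ⟩
      w n ∎

    -- On r + s = n + 1, 1 - b^(n+1) = (1 - b^r) + b^r (1 - b^s). The first part cancels a factor of
    -- (b)ᵣ, lowers r and leaves u; the second cancels one of (b)ₛ, lowers s and leaves -b^n. The
    -- two end terms vanish.
    sum-suc : ∀ n → (1# - b ^ suc n) * antidiagonal (suc n) term ≈ (u - b ^ n) * antidiagonal n term
    sum-suc n = begin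
      (1# - b ^ suc n) * antidiagonal (suc n) term
        ≈⟨ antidiagonal-* (suc n) (1# - b ^ suc n) term ⟨
      antidiagonal (suc n) (λ r s → (1# - b ^ suc n) * term r s)
        ≈⟨ antidiagonal-cong (suc n) split ⟩
      antidiagonal (suc n) (λ r s → α r s + β r s)
        ≈⟨ antidiagonal-+ (suc n) α β ⟩
      antidiagonal (suc n) α + antidiagonal (suc n) β
        ≈⟨ +-cong (antidiagonal-last n α) (+-congʳ β-zero) ⟩
      (antidiagonal n (λ r s → α (suc r) s) + α 0 (suc n)) + (0# + antidiagonal n (λ r s → β r (suc s)))
        ≈⟨ +-cong (+-cong (antidiagonal-cong n (λ r s _ → α-suc r s)) α-zero) (+-congˡ (antidiagonal-cong n β-suc)) ⟩
      (antidiagonal n (λ r s → u * term r s) + 0#) + (0# + antidiagonal n (λ r s → - (b ^ n) * term r s))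
        ≈⟨ +-cong (+-congʳ (antidiagonal-* n u term)) (+-congˡ (antidiagonal-* n (- (b ^ n)) term)) ⟩
      (u * antidiagonal n term + 0#) + (0# + - (b ^ n) * antidiagonal n term)
        ≈⟨ solve 3 (λ u c d → (u :* d :+ con ℤ.0ℤ) :+ (con ℤ.0ℤ :+ (:- c) :* d) := (u :- c) :* d) refl
                 u (b ^ n) (antidiagonal n term) ⟩
      (u - b ^ n) * antidiagonal n term ∎
      where
      α β : ℕ → ℕ → Carrier
      α r s = (1# - b ^ r) * term r s
      β r s = b ^ r * (1# - b ^ s) * term r s

      split : ∀ r s → r ℕ.+ s ≡ suc n → (1# - b ^ suc n) * term r s ≈ α r s + β r s
      split r s eq = begin
        (1# - b ^ suc n) * term r s
          ≈⟨ *-congʳ (+-congˡ (-‿cong (trans (^-congʳ b (≡.sym eq)) (^-homo-* b r s)))) ⟩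
        (1# - b ^ r * b ^ s) * term r s
          ≈⟨ solve 3 (λ x y t → (con 1ℤ :- x :* y) :* t := (con 1ℤ :- x) :* t :+ x :* (con 1ℤ :- y) :* t)
                   refl (b ^ r) (b ^ s) (term r s) ⟩
        α r s + β r s ∎

      α-zero : α 0 (suc n) ≈ 0#
      α-zero = solve 1 (λ t → (con 1ℤ :- con 1ℤ) :* t := con ℤ.0ℤ) refl (term 0 (suc n))

      β-zero : β (suc n) 0 ≈ 0#
      β-zero = solve 2 (λ x t → x :* (con 1ℤ :- con 1ℤ) :* t := con ℤ.0ℤ) refl (b ^ suc n) (term (suc n) 0)

      α-suc : ∀ r s → α (suc r) s ≈ u * term r s
      α-suc r s = begin
        (1# - b ^ suc r) * (w (suc r) * w s * (triPower b s * u ^ suc r))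
          ≈⟨ solve 6 (λ c x y v u z → c :* (x :* y :* (v :* (u :* z))) := u :* (c :* x :* y :* (v :* z)))
                   refl (1# - b ^ suc r) (w (suc r)) (w s) (triPower b s) u (u ^ r) ⟩
        u * ((1# - b ^ suc r) * w (suc r) * w s * (triPower b s * u ^ r))
          ≈⟨ *-congˡ (*-congʳ (*-congʳ (w-suc r))) ⟩
        u * term r s ∎

      β-suc : ∀ r s → r ℕ.+ s ≡ n → β r (suc s) ≈ - (b ^ n) * term r s
      β-suc r s eq = begin
        b ^ r * (1# - b ^ suc s) * (w r * w (suc s) * (- (b ^ s) * triPower b s * u ^ r))
          ≈⟨ solve 7 (λ d c x y e v z → d :* c :* (x :* y :* ((:- e) :* v :* z)) := (:- (d :* e)) :* (x :* (c :* y) :* (v :* z)))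
                   refl (b ^ r) (1# - b ^ suc s) (w r) (w (suc s)) (b ^ s) (triPower b s) (u ^ r) ⟩
        - (b ^ r * b ^ s) * (w r * ((1# - b ^ suc s) * w (suc s)) * (triPower b s * u ^ r))
          ≈⟨ *-cong (-‿cong (trans (sym (^-homo-* b r s)) (^-congʳ b eq))) (*-congʳ (*-congˡ (w-suc s))) ⟩
        - (b ^ n) * term r s ∎

    rothe : ∀ n → falling u b n ≈ poch b b n * antidiagonal n term
    rothe zero    = begin
      1#                                       ≈⟨ trans (*-cong (w-inverse 0) (w-inverse 0)) (*-identityˡ 1#) ⟨
      1# * w 0 * (1# * w 0)
        ≈⟨ solve 1 (λ w → con 1ℤ :* w :* (con 1ℤ :* w) := con 1ℤ :* (w :* w :* (con 1ℤ :* con 1ℤ))) refl (w 0) ⟩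
      1# * (w 0 * w 0 * (1# * 1#))             ∎
    rothe (suc n) = begin
      falling u b n * (u - b ^ n)
        ≈⟨ *-congʳ (rothe n) ⟩
      poch b b n * antidiagonal n term * (u - b ^ n)
        ≈⟨ solve 3 (λ p d c → p :* d :* c := p :* (c :* d)) refl (poch b b n) (antidiagonal n term) (u - b ^ n) ⟩
      poch b b n * ((u - b ^ n) * antidiagonal n term)
        ≈⟨ *-congˡ (sum-suc n) ⟨
      poch b b n * ((1# - b ^ suc n) * antidiagonal (suc n) term)
        ≈⟨ *-assoc _ _ _ ⟨
      poch b b (suc n) * antidiagonal (suc n) term ∎

    -- Rothe's product of 2N + 1 factors is split after the first N + 1: at u = b^N y these give (y;
    -- b), and the last N give (x; b) because u x = b^(N+1).
    finite-jacobi : ∀ {x y} N → x * y ≈ b → u ≈ b ^ N * y →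
                    triPower b (suc N) * poch y b (suc N) * (u ^ N * poch x b N)
                      ≈ poch b b (suc N ℕ.+ N) * antidiagonal (suc N ℕ.+ N) term
    finite-jacobi {x} {y} N xy≈b u≈ = begin
      triPower b (suc N) * poch y b (suc N) * (u ^ N * poch x b N)
        ≈⟨ *-congʳ (falling-low y b N) ⟨
      falling (b ^ N * y) b (suc N) * (u ^ N * poch x b N)
        ≈⟨ *-congʳ (falling-cong b (suc N) u≈) ⟨
      falling u b (suc N) * (u ^ N * poch x b N)
        ≈⟨ falling-high b (suc N) N ux≈ ⟨
      falling u b (suc N ℕ.+ N)
        ≈⟨ rothe (suc N ℕ.+ N) ⟩
      poch b b (suc N ℕ.+ N) * antidiagonal (suc N ℕ.+ N) term ∎
      where
      ux≈ : u * x ≈ b ^ suc N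
      ux≈ = begin
        u * x                ≈⟨ *-congʳ u≈ ⟩
        b ^ N * y * x        ≈⟨ solve 3 (λ c y x → c :* y :* x := x :* y :* c) refl (b ^ N) y x ⟩
        x * y * b ^ N        ≈⟨ *-congʳ xy≈b ⟩
        b ^ suc N            ∎

  -- Applied with E = (-q)∞, U = (q)∞ and V = 1 / (q)∞. For P = E V one has φ P = 1 and P = 1 + 2g
  -- with g = h V; the multiple of 4 in the result is spelt as repeated addition.
  square-inverse-mod-4 : ∀ {φ E U V h} F → φ * E ≈ U → U * V ≈ 1# → E ≈ U + (h + h) →
    E * F * V ≈ (1# + 1# - φ) * F + ((φ * (h * V * (h * V)) * F + φ * (h * V * (h * V)) * F)
                                   + (φ * (h * V * (h * V)) * F + φ * (h * V * (h * V)) * F))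
  square-inverse-mod-4 {φ} {E} {U} {V} {h} F φE≈U UV≈1 E≈ = begin
    E * F * V
      ≈⟨ solve 3 (λ E F V → E :* F :* V := E :* V :* F) refl E F V ⟩
    P * F
      ≈⟨ *-congʳ P≈ ⟩
    (φ + (1# + 1# - (φ + φ)) + four) * F
      ≈⟨ solve 3 (λ φ g F → (φ :+ (con 1ℤ :+ con 1ℤ :- (φ :+ φ))
                                :+ ((φ :* g :+ φ :* g) :+ (φ :* g :+ φ :* g))) :* F
                  := (con 1ℤ :+ con 1ℤ :- φ) :* F :+ ((φ :* g :* F :+ φ :* g :* F) :+ (φ :* g :* F :+ φ :* g :* F)))
               refl φ (h * V * (h * V)) F ⟩
    (1# + 1# - φ) * F + ((φ * (h * V * (h * V)) * F + φ * (h * V * (h * V)) * F)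
                                   + (φ * (h * V * (h * V)) * F + φ * (h * V * (h * V)) * F)) ∎
    where
    P g four : Carrier
    P    = E * V
    g    = h * V
    four = (φ * (g * g) + φ * (g * g)) + (φ * (g * g) + φ * (g * g))
    P≈1+2g : P ≈ 1# + (g + g)
    P≈1+2g = begin
      E * V                      ≈⟨ *-congʳ E≈ ⟩
      (U + (h + h)) * V          ≈⟨ solve 3 (λ U h V → (U :+ (h :+ h)) :* V := U :* V :+ (h :* V :+ h :* V)) refl U h V ⟩
      U * V + (g + g)            ≈⟨ +-congʳ UV≈1 ⟩
      1# + (g + g)               ∎
    φP≈1 : φ * P ≈ 1#
    φP≈1 = begin
      φ * (E * V)                ≈⟨ *-assoc φ E V ⟨
      φ * E * V                  ≈⟨ *-congʳ φE≈U ⟩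
      U * V                      ≈⟨ UV≈1 ⟩
      1#                         ∎
    -- P = φ P² = φ (1 + 2g)² and 2 φ g = φ P - φ = 1 - φ
    P≈ : P ≈ φ + (1# + 1# - (φ + φ)) + four
    P≈ = begin
      P                                   ≈⟨ *-identityˡ P ⟨
      1# * P                              ≈⟨ *-congʳ φP≈1 ⟨
      φ * P * P                           ≈⟨ *-cong (*-congˡ P≈1+2g) P≈1+2g ⟩
      φ * (1# + (g + g)) * (1# + (g + g))
        ≈⟨ solve 2 (λ φ g → φ :* (con 1ℤ :+ (g :+ g)) :* (con 1ℤ :+ (g :+ g))
                    := φ :+ (φ :* (con 1ℤ :+ (g :+ g)) :+ φ :* (con 1ℤ :+ (g :+ g)) :- (φ :+ φ))
                       :+ ((φ :* (g :* g) :+ φ :* (g :* g)) :+ (φ :* (g :* g) :+ φ :* (g :* g))))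
                 refl φ g ⟩
      φ + (φ * (1# + (g + g)) + φ * (1# + (g + g)) - (φ + φ)) + four
        ≈⟨ +-congʳ (+-congˡ (+-congʳ (+-cong φQ≈1 φQ≈1))) ⟩
      φ + (1# + 1# - (φ + φ)) + four ∎
      where
      φQ≈1 : φ * (1# + (g + g)) ≈ 1#
      φQ≈1 = trans (*-congˡ (sym P≈1+2g)) φP≈1

  -- Half of (-b; b)ₙ - (b; b)ₙ, defined without division through (p + 2h)(1 + x) = p (1 - x) + 2 (h
  -- (1 + x) + p x).
  half-difference : Carrier → ℕ → Carrier
  half-difference b zero    = 0#
  half-difference b (suc n) = half-difference b n * (1# + b * b ^ n) + poch b b n * (b * b ^ n)

  poch-neg-difference : ∀ b n → poch (- b) b n ≈ poch b b n + (half-difference b n + half-difference b n)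
  poch-neg-difference b zero    = solve 0 (con 1ℤ := con 1ℤ :+ (con ℤ.0ℤ :+ con ℤ.0ℤ)) refl
  poch-neg-difference b (suc n) = begin
    poch (- b) b n * (1# - - b * b ^ n)
      ≈⟨ *-congʳ (poch-neg-difference b n) ⟩
    (poch b b n + (half-difference b n + half-difference b n)) * (1# - - b * b ^ n)
      ≈⟨ solve 4 (λ p h b c → (p :+ (h :+ h)) :* (con 1ℤ :- (:- b) :* c)
               := p :* (con 1ℤ :- b :* c) :+ ((h :* (con 1ℤ :+ b :* c) :+ p :* (b :* c))
                                           :+ (h :* (con 1ℤ :+ b :* c) :+ p :* (b :* c))))
               refl (poch b b n) (half-difference b n) b (b ^ n) ⟩
    poch b b (suc n) + (half-difference b (suc n) + half-difference b (suc n)) ∎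

  geometric : Carrier → ℕ → Carrier
  geometric x zero    = 0#
  geometric x (suc n) = geometric x n + x ^ n

  geometric-* : ∀ x n → (1# - x) * geometric x n ≈ 1# - x ^ n
  geometric-* x zero    = solve 1 (λ x → (con 1ℤ :- x) :* con ℤ.0ℤ := con 1ℤ :- con 1ℤ) refl x
  geometric-* x (suc n) = begin
    (1# - x) * (geometric x n + x ^ n)                ≈⟨ distribˡ _ _ _ ⟩
    (1# - x) * geometric x n + (1# - x) * x ^ n       ≈⟨ +-congʳ (geometric-* x n) ⟩
    1# - x ^ n + (1# - x) * x ^ n
      ≈⟨ solve 2 (λ x c → con 1ℤ :- c :+ (con 1ℤ :- x) :* c := con 1ℤ :- x :* c) refl x (x ^ n) ⟩
    1# - x ^ suc n                                    ∎

  -- The finite form of Jacobi's triple product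

  module FiniteJacobi (z : Carrier) (i d N : ℕ) (w : ℕ → Carrier)
                      (w-inverse : ∀ n → poch (z ^ (i ℕ.+ d)) (z ^ (i ℕ.+ d)) n * w n ≈ 1#) where

    -- The parameter d stands for k - i, so that k is a sum and no subtraction occurs; c is the
    -- exponent of u = b^N z^d with b = z^k.
    k c : ℕ
    k = i ℕ.+ d
    c = k ℕ.* N ℕ.+ d

    open Rothe (z ^ k) (z ^ c) w w-inverse public

    P : ℕ → Carrier
    P = poch (z ^ k) (z ^ k)

    -- The multipliers p and p′ are to be Pochhammer symbols (b)ₙ so long that p / (b)ᵣ and p′ /
    -- (b)ₛ are close to 1; what is left of the summand is a signed monomial.
    monomial : ∀ p p′ r s →
               p * p′ * term r s ≈ sign s * (z ^ (k ℕ.* triangle s ℕ.+ c ℕ.* r) * (p * w r * (p′ * w s)))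
    monomial p p′ r s = begin
      p * p′ * (w r * w s * (triPower (z ^ k) s * (z ^ c) ^ r))
        ≈⟨ *-congˡ (*-congˡ (triPower-*-monomial z k c s r)) ⟩
      p * p′ * (w r * w s * (sign s * z ^ (k ℕ.* triangle s ℕ.+ c ℕ.* r)))
        ≈⟨ solve 6 (λ p p′ x y e m → p :* p′ :* (x :* y :* (e :* m)) := e :* (m :* (p :* x :* (p′ :* y)))) refl
                 p p′ (w r) (w s) (sign s) (z ^ (k ℕ.* triangle s ℕ.+ c ℕ.* r)) ⟩
      sign s * (z ^ (k ℕ.* triangle s ℕ.+ c ℕ.* r) * (p * w r * (p′ * w s))) ∎

    swap : ∀ p p′ r s → p * w r * (p′ * w s) ≈ p * w s * (p′ * w r)
    swap p p′ r s = solve 4 (λ p p′ x y → p :* x :* (p′ :* y) := p :* y :* (p′ :* x)) refl p p′ (w r) (w s)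

    -- The monomial on the left is that of `triPower (z ^ k) (suc N)` and uᴺ; its sign is its own
    -- inverse and moves to the right.
    jacobi : z ^ (k ℕ.* triangle (suc N) ℕ.+ c ℕ.* N) * (poch (z ^ i) (z ^ k) N * poch (z ^ d) (z ^ k) (suc N) * P N)
               ≈ sign (suc N) * antidiagonal (suc N ℕ.+ N) (λ r s → P N * P (suc N ℕ.+ N) * term r s)
    jacobi = begin
      m * (A * B * P N)
        ≈⟨ sign-cancel (suc N) _ ⟨
      σ * (σ * (m * (A * B * P N)))
        ≈⟨ *-congˡ (solve 5 (λ e m a b p → e :* (m :* (a :* b :* p)) := p :* (e :* m :* (a :* b))) refl σ m A B (P N)) ⟩
      σ * (P N * (σ * m * (A * B)))
        ≈⟨ *-congˡ (*-congˡ (*-congʳ (triPower-*-monomial z k c (suc N) N))) ⟨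
      σ * (P N * (triPower (z ^ k) (suc N) * (z ^ c) ^ N * (A * B)))
        ≈⟨ *-congˡ (*-congˡ (solve 4 (λ x y a b → x :* y :* (a :* b) := x :* b :* (y :* a)) refl _ _ A B)) ⟩
      σ * (P N * (triPower (z ^ k) (suc N) * B * ((z ^ c) ^ N * A)))
        ≈⟨ *-congˡ (*-congˡ (finite-jacobi N (sym (^-homo-* z i d)) c-split)) ⟩
      σ * (P N * (P (suc N ℕ.+ N) * antidiagonal (suc N ℕ.+ N) term))
        ≈⟨ *-congˡ (trans (antidiagonal-* (suc N ℕ.+ N) _ term) (*-assoc _ _ _)) ⟨
      σ * antidiagonal (suc N ℕ.+ N) (λ r s → P N * P (suc N ℕ.+ N) * term r s) ∎
      where
      m A B σ : Carrier
      m = z ^ (k ℕ.* triangle (suc N) ℕ.+ c ℕ.* N)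
      A = poch (z ^ i) (z ^ k) N
      B = poch (z ^ d) (z ^ k) (suc N)
      σ = sign (suc N)
      c-split : z ^ c ≈ (z ^ k) ^ N * z ^ d
      c-split = trans (^-homo-* z (k ℕ.* N) d) (*-congʳ (sym (^-assocʳ z k N)))

  rearrange : ∀ a b c → a * a * b * c ≈ a * (c * (a * b))
  rearrange a b c = solve 3 (λ a b c → a :* a :* b :* c := a :* (c :* (a :* b))) refl a b c

-- Formal power series

module SeriesRing where
  open D using (_*_; 1#; -_)
  open Pointwise ℕ using (isAbelianGroup)
  open ≡.≡-Reasoning
  open +-*-Solver using (solve; con; _:=_; _:+_; _:*_)

  infixl 6 _+_
  infix  4 _≈_

  _≈_ : Series → Series → Set
  f ≈ g = ∀ n → f n ≡ g n

  _+_ : Series → Series → Series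
  (f + g) n = f n ℤ.+ g n

  0# : Series
  0# n = 0ℤ

  infix 4 _≈[_]_
  -- Congruence modulo q^N, the sense in which finite products approximate infinite ones.
  _≈[_]_ : Series → ℕ → Series → Set
  f ≈[ N ] g = ∀ n → n ℕ.< N → f n ≡ g n

  -- By the definition of `sum`, `(f * g) (suc n)` unfolds to `f 0 ℤ.* g (suc n)` plus
  -- `((f ∘ suc) * g) n`. The inductions on products run along this unfolding.
  *-cong-at : ∀ n {f f′ g g′} → f ≈[ suc n ] f′ → g ≈[ suc n ] g′ → (f * g) n ≡ (f′ * g′) n
  *-cong-at zero    p r = cong (ℤ._+ 0ℤ) (cong₂ ℤ._*_ (p 0 (s≤s z≤n)) (r 0 (s≤s z≤n)))
  *-cong-at (suc n) p r =
    cong₂ ℤ._+_ (cong₂ ℤ._*_ (p 0 (s≤s z≤n)) (r (suc n) ℕ.≤-refl))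
                (*-cong-at n (λ m m<n → p (suc m) (s≤s m<n)) (λ m m<n → r m (ℕ.m<n⇒m<1+n m<n)))

  -- The mirror image of the definitional unfolding, splitting off the last summand; commutativity
  -- follows by comparing the two.
  *-suc-last : ∀ f g n → (f * g) (suc n) ≡ (f * (g ∘ suc)) n ℤ.+ f (suc n) ℤ.* g 0
  *-suc-last f g zero    =
    solve 4 (λ a b c d → a :* b :+ (c :* d :+ con 0ℤ) := (a :* b :+ con 0ℤ) :+ c :* d) ≡.refl
      (f 0) (g 1) (f 1) (g 0)
  *-suc-last f g (suc n) =
    ≡.trans (cong (λ z → f 0 ℤ.* g (suc (suc n)) ℤ.+ z) (*-suc-last (f ∘ suc) g n))
            (≡.sym (ℤ.+-assoc (f 0 ℤ.* g (suc (suc n))) _ _))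

  *-comm : ∀ f g → f * g ≈ g * f
  *-comm f g zero    = cong (ℤ._+ 0ℤ) (ℤ.*-comm (f 0) (g 0))
  *-comm f g (suc n) = begin
    f 0 ℤ.* g (suc n) ℤ.+ ((f ∘ suc) * g) n    ≡⟨ cong₂ ℤ._+_ (ℤ.*-comm (f 0) (g (suc n))) (*-comm (f ∘ suc) g n) ⟩
    g (suc n) ℤ.* f 0 ℤ.+ (g * (f ∘ suc)) n    ≡⟨ ℤ.+-comm (g (suc n) ℤ.* f 0) _ ⟩
    (g * (f ∘ suc)) n ℤ.+ g (suc n) ℤ.* f 0    ≡⟨ *-suc-last g f n ⟨
    (g * f) (suc n)                            ∎

  *-distribʳ : ∀ h f g → (f + g) * h ≈ f * h + g * h
  *-distribʳ h f g zero    =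
    solve 3 (λ f g h → (f :+ g) :* h :+ con 0ℤ := (f :* h :+ con 0ℤ) :+ (g :* h :+ con 0ℤ)) ≡.refl
      (f 0) (g 0) (h 0)
  *-distribʳ h f g (suc n) =
    ≡.trans (cong (ℤ._+_ ((f 0 ℤ.+ g 0) ℤ.* h (suc n))) (*-distribʳ h (f ∘ suc) (g ∘ suc) n))
            (solve 5 (λ f g h x y → (f :+ g) :* h :+ (x :+ y) := (f :* h :+ x) :+ (g :* h :+ y)) ≡.refl
              (f 0) (g 0) (h (suc n)) _ _)

  scale-* : ∀ c f g n → ((λ m → c ℤ.* f m) * g) n ≡ c ℤ.* (f * g) n
  scale-* c f g zero    =
    solve 3 (λ c f g → c :* f :* g :+ con 0ℤ := c :* (f :* g :+ con 0ℤ)) ≡.refl c (f 0) (g 0)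
  scale-* c f g (suc n) =
    ≡.trans (cong (ℤ._+_ (c ℤ.* f 0 ℤ.* g (suc n))) (scale-* c (f ∘ suc) g n))
            (solve 4 (λ c f g x → c :* f :* g :+ c :* x := c :* (f :* g :+ x)) ≡.refl
              c (f 0) (g (suc n)) _)

  *-assoc : ∀ f g h → (f * g) * h ≈ f * (g * h)
  *-assoc f g h zero    =
    solve 3 (λ f g h → (f :* g :+ con 0ℤ) :* h :+ con 0ℤ := f :* (g :* h :+ con 0ℤ) :+ con 0ℤ) ≡.refl
      (f 0) (g 0) (h 0)
  *-assoc f g h (suc n) = begin
    -- The shifted series `(f * g) ∘ suc` is by definition the multiple of `g ∘ suc` by `f 0` plus
    -- `(f ∘ suc) * g`.
    (f * g) 0 ℤ.* h (suc n) ℤ.+ (((λ m → f 0 ℤ.* g (suc m)) + (f ∘ suc) * g) * h) n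
      ≡⟨ cong (ℤ._+_ ((f * g) 0 ℤ.* h (suc n))) (*-distribʳ h (λ m → f 0 ℤ.* g (suc m)) ((f ∘ suc) * g) n) ⟩
    (f * g) 0 ℤ.* h (suc n) ℤ.+ (((λ m → f 0 ℤ.* g (suc m)) * h) n ℤ.+ (((f ∘ suc) * g) * h) n)
      ≡⟨ cong (ℤ._+_ ((f * g) 0 ℤ.* h (suc n))) (cong₂ ℤ._+_ (scale-* (f 0) (g ∘ suc) h n) (*-assoc (f ∘ suc) g h n)) ⟩
    (f * g) 0 ℤ.* h (suc n) ℤ.+ (f 0 ℤ.* ((g ∘ suc) * h) n ℤ.+ ((f ∘ suc) * (g * h)) n)
      ≡⟨ solve 5 (λ f g h x y → (f :* g :+ con 0ℤ) :* h :+ (f :* x :+ y) := f :* (g :* h :+ x) :+ y) ≡.refl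
           (f 0) (g 0) (h (suc n)) _ _ ⟩
    (f * (g * h)) (suc n) ∎

  *-zeroˡ : ∀ g → 0# * g ≈ 0#
  *-zeroˡ g zero    = ≡.refl
  *-zeroˡ g (suc n) = ≡.trans (ℤ.+-identityˡ _) (*-zeroˡ g n)

  *-identityˡ : ∀ g → 1# * g ≈ g
  *-identityˡ g zero    = ≡.trans (ℤ.+-identityʳ _) (ℤ.*-identityˡ (g 0))
  *-identityˡ g (suc n) =
    ≡.trans (cong₂ ℤ._+_ (ℤ.*-identityˡ (g (suc n))) (*-zeroˡ g n)) (ℤ.+-identityʳ _)

  seriesRing : CommutativeRing 0ℓ 0ℓ
  seriesRing = record
    { Carrier = Series
    ; _≈_     = _≈_
    ; _+_     = _+_
    ; _*_     = _*_
    ; -_      = -_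
    ; 0#      = 0#
    ; 1#      = 1#
    ; isCommutativeRing = record
      { isRing = record
        { +-isAbelianGroup = isAbelianGroup ℤ.+-0-isAbelianGroup
        ; *-cong     = λ p r n → *-cong-at n (λ m _ → p m) (λ m _ → r m)
        ; *-assoc    = *-assoc
        ; *-identity = *-identityˡ , λ f n → ≡.trans (*-comm f 1# n) (*-identityˡ f n)
        ; distrib    = (λ f g h n → ≡.trans (*-comm f (g + h) n)
                                     (≡.trans (*-distribʳ f g h n) (cong₂ ℤ._+_ (*-comm g f n) (*-comm h f n))))
                       , *-distribʳ
        }
      ; *-comm = *-comm
      }
    }

-- Congruences modulo powers of q for products and inverses

module Truncation where
  open SeriesRing using (seriesRing; _≈[_]_; *-cong-at)
  open CommutativeRing seriesRing
  open import Algebra.Properties.CommutativeSemiring.Exp commutativeSemiring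
  open FiniteProducts seriesRing
  open +-*-Solver using (solve; _:=_; _:-_)

  ≈⇒≈[] : ∀ {f g} N → f ≈ g → f ≈[ N ] g
  ≈⇒≈[] N eq n _ = eq n

  ≈[]-sym : ∀ {f g} N → f ≈[ N ] g → g ≈[ N ] f
  ≈[]-sym N p n n<N = ≡.sym (p n n<N)

  ≈[]-trans : ∀ {f g h} N → f ≈[ N ] g → g ≈[ N ] h → f ≈[ N ] h
  ≈[]-trans N p r n n<N = ≡.trans (p n n<N) (r n n<N)

  ≈[]-weaken : ∀ {f g M N} → M ≤ N → f ≈[ N ] g → f ≈[ M ] g
  ≈[]-weaken M≤N p n n<M = p n (ℕ.≤-trans n<M M≤N)

  *-cong[] : ∀ {f f′ g g′} N → f ≈[ N ] f′ → g ≈[ N ] g′ → f * g ≈[ N ] f′ * g′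
  *-cong[] N p r n n<N = *-cong-at n (≈[]-weaken n<N p) (≈[]-weaken n<N r)

  *-zeroʳ[] : ∀ {f} g N → f ≈[ N ] 0# → g * f ≈[ N ] 0#
  *-zeroʳ[] {f} g N p = ≈[]-trans {g * f} {g * 0#} N (*-cong[] {g} {g} N (λ _ _ → ≡.refl) p) (≈⇒≈[] N (zeroʳ g))

  1-f*g≈[]1 : ∀ f {g} N → g ≈[ N ] 0# → 1# - f * g ≈[ N ] 1#
  1-f*g≈[]1 f {g} N p n n<N =
    ≡.trans (cong (λ z → 1# n ℤ.+ ℤ.- z) (*-zeroʳ[] {g} f N p n n<N)) (ℤ.+-identityʳ (1# n))

  q-suc : ∀ f n → (q * f) (suc n) ≡ f n
  q-suc f n = begin
    0ℤ ℤ.+ ((q ∘ suc) * f) n    ≡⟨ ℤ.+-identityˡ _ ⟩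
    ((q ∘ suc) * f) n           ≡⟨ *-congʳ {f} {q ∘ suc} {1#} q∘suc≈1 n ⟩
    (1# * f) n                  ≡⟨ *-identityˡ f n ⟩
    f n                         ∎
    where
    open ≡.≡-Reasoning
    q∘suc≈1 : q ∘ suc ≈ 1#
    q∘suc≈1 zero    = ≡.refl
    q∘suc≈1 (suc n) = ≡.refl

  q^-shift : ∀ e f n → (q ^ e * f) (e ℕ.+ n) ≡ f n
  q^-shift zero    f n = *-identityˡ f n
  q^-shift (suc e) f n =
    ≡.trans (*-assoc q (q ^ e) f (suc e ℕ.+ n)) (≡.trans (q-suc (q ^ e * f) (e ℕ.+ n)) (q^-shift e f n))

  q^-low : ∀ e f → q ^ e * f ≈[ e ] 0#
  q^-low (suc e) f zero    n<e       = *-assoc q (q ^ e) f 0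
  q^-low (suc e) f (suc n) (s≤s n<e) =
    ≡.trans (*-assoc q (q ^ e) f (suc n)) (≡.trans (q-suc (q ^ e * f) n) (q^-low e f n n<e))

  -- The powers of b tend to 0 in the q-adic sense, which makes (a; b)∞ converge coefficientwise.
  Adic : Series → Set
  Adic b = ∀ m → b ^ m ≈[ m ] 0#

  q-adic : Adic q
  q-adic m = ≈[]-trans {q ^ m} {q ^ m * 1#} m (≈⇒≈[] m (sym {q ^ m * 1#} (*-identityʳ (q ^ m)))) (q^-low m 1#)

  q^-adic : ∀ k .{{_ : NonZero k}} → Adic (q ^ k)
  q^-adic k m = ≈[]-trans {(q ^ k) ^ m} {q ^ (k ℕ.* m)} m
    (≈⇒≈[] m (^-assocʳ q k m))
    (≈[]-weaken (ℕ.m≤n*m m k) (q-adic (k ℕ.* m)))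

  -- Carries the power of the definitions over to the library power, to which the exponent laws
  -- apply.
  D^≈^ : ∀ {f g} n → f ≈ g → f D.^ n ≈ g ^ n
  D^≈^ zero    eq = refl {1#}
  D^≈^ {f} {g} (suc n) eq = *-cong {f} {g} {f D.^ n} {g ^ n} eq (D^≈^ n eq)

  ∏<-poch : ∀ {a a′ b b′} N → a ≈ a′ → b ≈ b′ → ∏< N (λ m → 1# - a * b D.^ m) ≈ poch a′ b′ N
  ∏<-poch zero    eqa eqb = refl {1#}
  ∏<-poch {a} {a′} {b} {b′} (suc N) eqa eqb =
    *-cong {∏< N (λ m → 1# - a * b D.^ m)} {poch a′ b′ N} (∏<-poch N eqa eqb)
      (λ n → cong (λ z → 1# n ℤ.+ ℤ.- z) (*-cong {a} {a′} {b D.^ N} {b′ ^ N} eqa (D^≈^ N eqb) n))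

  -- The factors of index at least N are 1 modulo q^N.
  poch-stable : ∀ a {b} → Adic b → ∀ N t → poch a b (t ℕ.+ N) ≈[ N ] poch a b N
  poch-stable a     adic N zero    = λ _ _ → ≡.refl
  poch-stable a {b} adic N (suc t) =
    ≈[]-trans {poch a b (suc (t ℕ.+ N))} {poch a b N * 1#} N
      (*-cong[] {poch a b (t ℕ.+ N)} N (poch-stable a adic N t)
        (1-f*g≈[]1 a {b ^ (t ℕ.+ N)} N (≈[]-weaken (ℕ.m≤n+m N t) (adic (t ℕ.+ N)))))
      (≈⇒≈[] N (*-identityʳ (poch a b N)))

  -- Coefficient n of the infinite product is read off from n + 1 factors; the further ones up to N
  -- leave it unchanged.
  ⟨⟩∞≈[]poch : ∀ {a a′ b b′} N → a ≈ a′ → b ≈ b′ → Adic b′ → ⟨ a ⨾ b ⟩∞ ≈[ N ] poch a′ b′ N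
  ⟨⟩∞≈[]poch {a} {a′} {b} {b′} N eqa eqb adic n n<N = begin
    ∏< (suc n) (λ m → 1# - a * b D.^ m) n        ≡⟨ ∏<-poch (suc n) eqa eqb n ⟩
    poch a′ b′ (suc n) n                         ≡⟨ poch-stable a′ adic (suc n) (N ℕ.∸ suc n) n ℕ.≤-refl ⟨
    poch a′ b′ (N ℕ.∸ suc n ℕ.+ suc n) n         ≡⟨ cong (λ M → poch a′ b′ M n) (ℕ.m∸n+n≡m n<N) ⟩
    poch a′ b′ N n                               ∎
    where open ≡.≡-Reasoning

  vanishing-^ : ∀ f → f 0 ≡ 0ℤ → Adic f
  vanishing-^ f f0 (suc m) zero    n<m       =
    ≡.trans (ℤ.+-identityʳ _) (≡.trans (cong (ℤ._* (f ^ m) 0) f0) (ℤ.*-zeroˡ ((f ^ m) 0)))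
  vanishing-^ f f0 (suc m) (suc n) (s≤s n<m) = begin
    f 0 ℤ.* (f ^ m) (suc n) ℤ.+ ((f ∘ suc) * f ^ m) n
      ≡⟨ cong₂ ℤ._+_ (≡.trans (cong (ℤ._* (f ^ m) (suc n)) f0) (ℤ.*-zeroˡ ((f ^ m) (suc n))))
                     (*-zeroʳ[] {f ^ m} (f ∘ suc) m (vanishing-^ f f0 m) n n<m) ⟩
    0ℤ ∎
    where open ≡.≡-Reasoning

  sum-powers : ∀ x N n → ℤSum.sum {N} (λ j → (x D.^ toℕ j) n) ≡ geometric x N n
  sum-powers x zero    n = ≡.refl
  sum-powers x (suc N) n = begin
    ℤSum.sum {suc N} (λ j → (x D.^ toℕ j) n)
      ≡⟨ ℤSum.sum-init-last {N} (λ j → (x D.^ toℕ j) n) ⟩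
    ℤSum.sum {N} (λ j → (x D.^ toℕ (inject₁ j)) n) ℤ.+ (x D.^ toℕ (fromℕ N)) n
      ≡⟨ cong₂ ℤ._+_ (ℤSum.sum-cong-≗ {N} (λ j → cong (λ m → (x D.^ m) n) (Fin.toℕ-inject₁ j)))
                     (cong (λ m → (x D.^ m) n) (Fin.toℕ-fromℕ N)) ⟩
    ℤSum.sum {N} (λ j → (x D.^ toℕ j) n) ℤ.+ (x D.^ N) n
      ≡⟨ cong₂ ℤ._+_ (sum-powers x N n) (D^≈^ {x} {x} N (λ _ → ≡.refl) n) ⟩
    geometric x (suc N) n ∎
    where open ≡.≡-Reasoning

  geometric-stable : ∀ x → Adic x → ∀ N t → geometric x (t ℕ.+ N) ≈[ N ] geometric x N
  geometric-stable x adic N zero    n n<N = ≡.refl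
  geometric-stable x adic N (suc t) n n<N =
    ≡.trans (cong₂ ℤ._+_ (geometric-stable x adic N t n n<N) (adic (t ℕ.+ N) n (ℕ.≤-trans n<N (ℕ.m≤n+m N t))))
            (ℤ.+-identityʳ _)

  -- With x = 1 - f, the geometric sum of length n + 1 times 1 - x is 1 - x^(n+1), and x^(n+1) has
  -- no term of degree n since x has no constant term.
  ⁻¹-inverse : ∀ f → f 0 ≡ 1ℤ → f * f ⁻¹ ≈ 1#
  ⁻¹-inverse f f0 n = begin
    (f * f ⁻¹) n
      ≡⟨ *-cong-at n {f} {1# - x} {f ⁻¹} {geometric x (suc n)} (λ m _ → f≈ m) f⁻¹≈ ⟩
    ((1# - x) * geometric x (suc n)) n
      ≡⟨ geometric-* x (suc n) n ⟩
    1# n ℤ.- (x ^ suc n) n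
      ≡⟨ cong (λ z → 1# n ℤ.- z) (adic (suc n) n ℕ.≤-refl) ⟩
    1# n ℤ.- 0ℤ
      ≡⟨ ℤ.+-identityʳ (1# n) ⟩
    1# n ∎
    where
    open ≡.≡-Reasoning
    x : Series
    x = 1# - f
    adic : Adic x
    adic = vanishing-^ x (cong (λ z → 1ℤ ℤ.- z) f0)
    f≈ : f ≈ 1# - x
    f≈ m = solve 2 (λ a b → b := a :- (a :- b)) ≡.refl (1# m) (f m)
    f⁻¹≈ : f ⁻¹ ≈[ suc n ] geometric x (suc n)
    f⁻¹≈ m m<n = begin
      (f ⁻¹) m                                             ≡⟨ sum-powers x (suc m) m ⟩
      geometric x (suc m) m                                ≡⟨ geometric-stable x adic (suc m) (suc n ℕ.∸ suc m) m ℕ.≤-refl ⟨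
      geometric x (suc n ℕ.∸ suc m ℕ.+ suc m) m            ≡⟨ cong (λ N → geometric x N m) (ℕ.m∸n+n≡m m<n) ⟩
      geometric x (suc n) m                                ∎

-- The support of the triple product

module Exponents where
  open import Data.Nat using (_+_; _*_; s≤s; z≤n)
  open import Data.Nat.DivMod using ([m+kn]%n≡m%n)
  open import Data.Nat.Properties
  open import Data.Nat.Tactic.RingSolver using (solve-∀)
  open ≡ using (refl; sym; trans; module ≡-Reasoning)

  triangle-+ : ∀ m n → triangle (m + n) ≡ triangle m + triangle n + m * n
  triangle-+ m zero    = begin
    triangle (m + 0)             ≡⟨ cong triangle (+-identityʳ m) ⟩
    triangle m                   ≡⟨ lemma m (triangle m) ⟩
    triangle m + 0 + m * 0       ∎
    where
    open ≡-Reasoning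
    lemma : ∀ m t → t ≡ t + 0 + m * 0
    lemma = solve-∀
  triangle-+ m (suc n) = begin
    triangle (m + suc n)                              ≡⟨ cong triangle (+-suc m n) ⟩
    triangle (m + n) + (m + n)                        ≡⟨ cong (_+ (m + n)) (triangle-+ m n) ⟩
    triangle m + triangle n + m * n + (m + n)         ≡⟨ lemma m n (triangle m) (triangle n) ⟩
    triangle m + (triangle n + n) + m * suc n         ∎
    where
    open ≡-Reasoning
    lemma : ∀ m n s t → s + t + m * n + (m + n) ≡ s + (t + n) + m * suc n
    lemma = solve-∀

  square≡2triangle+ : ∀ n → n * n ≡ triangle n + triangle n + n
  square≡2triangle+ zero    = refl
  square≡2triangle+ (suc n) = begin
    suc n * suc n                                              ≡⟨ lemma₁ n ⟩
    n * n + (n + n + 1)                                        ≡⟨ cong (_+ (n + n + 1)) (square≡2triangle+ n) ⟩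
    triangle n + triangle n + n + (n + n + 1)                  ≡⟨ lemma₂ n (triangle n) ⟩
    triangle n + n + (triangle n + n) + suc n                  ∎
    where
    open ≡-Reasoning
    lemma₁ : ∀ n → suc n * suc n ≡ n * n + (n + n + 1)
    lemma₁ = solve-∀
    lemma₂ : ∀ n t → t + t + n + (n + n + 1) ≡ t + n + (t + n) + suc n
    lemma₂ = solve-∀

  square%4<2 : ∀ n → n * n % 4 < 2
  square%4<2 zero          = s≤s z≤n
  square%4<2 (suc zero)    = s≤s (s≤s z≤n)
  square%4<2 (suc (suc n)) = subst (_< 2) (sym eq) (square%4<2 n)
    where
    open ≡-Reasoning
    lemma : ∀ n → (2 + n) * (2 + n) ≡ n * n + (1 + n) * 4
    lemma = solve-∀
    eq : suc (suc n) * suc (suc n) % 4 ≡ n * n % 4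
    eq = trans (cong (_% 4) (lemma n)) ([m+kn]%n≡m%n (n * n) (suc n) 4)

  -- Modulo 4 the exponent is 2 · m(m-1)/2 + m = m². The parameter γ is taken as α for the exponents
  -- with i, and as β for those with d = k - i.
  exponent%4<2 : ∀ α β γ m → (((1 + α * 4) + (1 + β * 4)) * triangle m + (1 + γ * 4) * m) % 4 < 2
  exponent%4<2 α β γ m = subst (_< 2) (sym eq) (square%4<2 m)
    where
    open ≡-Reasoning
    lemma : ∀ α β γ m t → ((1 + α * 4) + (1 + β * 4)) * t + (1 + γ * 4) * m
                            ≡ (t + t + m) + ((α + β) * t + γ * m) * 4
    lemma = solve-∀
    eq : _ ≡ m * m % 4
    eq = begin
      (((1 + α * 4) + (1 + β * 4)) * triangle m + (1 + γ * 4) * m) % 4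
        ≡⟨ cong (_% 4) (lemma α β γ m (triangle m)) ⟩
      (triangle m + triangle m + m + ((α + β) * triangle m + γ * m) * 4) % 4
        ≡⟨ [m+kn]%n≡m%n (triangle m + triangle m + m) ((α + β) * triangle m + γ * m) 4 ⟩
      (triangle m + triangle m + m) % 4
        ≡⟨ cong (_% 4) (square≡2triangle+ m) ⟨
      m * m % 4 ∎

  -- With d standing for k - i, the second summand on the right is k m(m-1)/2 + i m at the negative
  -- Jacobi index m = s - N - 1 = -(l+1), rewritten with natural coefficients.
  exponent-low : ∀ k d {N r s l} → s + l ≡ N → N + suc l ≡ r →
    k * triangle s + (k * N + d) * r ≡ (k * triangle (suc N) + (k * N + d) * N) + (k * triangle (suc l) + d * suc l)
  exponent-low k d {_} {_} {s} {l} refl refl = begin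
    k * triangle s + (k * (s + l) + d) * (s + l + suc l)
      ≡⟨ lemma₁ k d s l (triangle s) ⟩
    k * triangle s + (k * (s + l) + d) * (s + l) + (k * s + d) * suc l + k * l + k * (l * l)
      ≡⟨ cong (λ x → k * triangle s + (k * (s + l) + d) * (s + l) + (k * s + d) * suc l + k * l + k * x) (square≡2triangle+ l) ⟩
    k * triangle s + (k * (s + l) + d) * (s + l) + (k * s + d) * suc l + k * l + k * (triangle l + triangle l + l)
      ≡⟨ lemma₂ k d s l (triangle s) (triangle l) ⟩
    (k * (triangle s + (triangle l + l) + s * suc l) + (k * (s + l) + d) * (s + l)) + (k * (triangle l + l) + d * suc l)
      ≡⟨ cong (λ x → (k * x + (k * (s + l) + d) * (s + l)) + (k * triangle (suc l) + d * suc l))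
              (trans (cong triangle (sym (+-suc s l))) (triangle-+ s (suc l))) ⟨
    (k * triangle (suc (s + l)) + (k * (s + l) + d) * (s + l)) + (k * triangle (suc l) + d * suc l) ∎
    where
    open ≡-Reasoning
    lemma₁ : ∀ k d s l t → k * t + (k * (s + l) + d) * (s + l + suc l)
                         ≡ k * t + (k * (s + l) + d) * (s + l) + (k * s + d) * suc l + k * l + k * (l * l)
    lemma₁ = solve-∀
    lemma₂ : ∀ k d s l t u → k * t + (k * (s + l) + d) * (s + l) + (k * s + d) * suc l + k * l + k * (u + u + l)
                           ≡ (k * (t + (u + l) + s * suc l) + (k * (s + l) + d) * (s + l)) + (k * (u + l) + d * suc l)
    lemma₂ = solve-∀

  -- The terms with Jacobi index m = s - N - 1 ≥ 0. The first summand on the right is the same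
  -- offset as in `exponent-low`.
  exponent-high : ∀ i d {N r s m} → r + m ≡ N → suc N + m ≡ s →
    (i + d) * triangle s + ((i + d) * N + d) * r
      ≡ ((i + d) * triangle (suc N) + ((i + d) * N + d) * N) + ((i + d) * triangle m + i * m)
  exponent-high i d {_} {r} {_} {m} refl refl = begin
    (i + d) * triangle (suc (r + m) + m) + ((i + d) * (r + m) + d) * r
      ≡⟨ cong (λ x → (i + d) * x + ((i + d) * (r + m) + d) * r) (triangle-+ (suc (r + m)) m) ⟩
    (i + d) * (triangle (suc (r + m)) + triangle m + suc (r + m) * m) + ((i + d) * (r + m) + d) * r
      ≡⟨ lemma i d r m (triangle (suc (r + m))) (triangle m) ⟩
    ((i + d) * triangle (suc (r + m)) + ((i + d) * (r + m) + d) * (r + m)) + ((i + d) * triangle m + i * m) ∎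
    where
    open ≡-Reasoning
    lemma : ∀ i d r m t u → (i + d) * (t + u + suc (r + m) * m) + ((i + d) * (r + m) + d) * r
                          ≡ ((i + d) * t + ((i + d) * (r + m) + d) * (r + m)) + ((i + d) * u + i * m)
    lemma = solve-∀

  -- Here a is the smaller of r and s, up to whose degree the cofactor of the monomial is known to
  -- be 1. As i ≥ 1, the exponent e of the monomial is at least m, so the degrees up to e + a cover
  -- all those below N.
  linear-bound : ∀ k i .{{_ : NonZero i}} {N a m} → N ≤ a + m → N ≤ k * triangle m + i * m + suc a
  linear-bound k i {N} {a} {m} N≤a+m = begin
    N                                    ≤⟨ N≤a+m ⟩
    a + m                                ≡⟨ +-comm a m ⟩
    m + a                                ≤⟨ +-mono-≤ (≤-trans (m≤n*m m i) (m≤n+m (i * m) (k * triangle m))) (n≤1+n a) ⟩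
    k * triangle m + i * m + suc a       ∎
    where open ≤-Reasoning

  complement-high : ∀ {N s} r m → r + s ≡ suc N + N → suc N + m ≡ s → r + m ≡ N
  complement-high {N} r m eq refl = +-cancelˡ-≡ (suc N) (r + m) N (trans (lemma N r m) eq)
    where
    open ≡-Reasoning
    lemma : ∀ N r m → suc N + (r + m) ≡ r + (suc N + m)
    lemma = solve-∀

  complement-low : ∀ {N r} s l → r + s ≡ suc N + N → s + l ≡ N → N + suc l ≡ r
  complement-low {_} {r} s l eq refl = +-cancelʳ-≡ s (s + l + suc l) r (trans (lemma s l) (sym eq))
    where
    open ≡-Reasoning
    lemma : ∀ s l → s + l + suc l + s ≡ suc (s + l) + (s + l)
    lemma = solve-∀

-- From the summands to the support of the triple product

module Support where
  open SeriesRing using (seriesRing; _≈[_]_)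
  open CommutativeRing seriesRing
  open import Algebra.Properties.CommutativeSemiring.Exp commutativeSemiring
  open FiniteProducts seriesRing
  open Truncation

  -- The offset M makes up for the monomial q^M by which the finite Jacobi identity multiplies the product.
  Vanish : ℕ → ℕ → Series → Set
  Vanish M N f = ∀ n → n < N → 2 ≤ n % 4 → f (M ℕ.+ n) ≡ 0ℤ

  Vanish-cong : ∀ {M N f g} → f ≈ g → Vanish M N g → Vanish M N f
  Vanish-cong {M} eq p n n<N bad = ≡.trans (eq (M ℕ.+ n)) (p n n<N bad)

  Vanish-sign : ∀ {M N f} s → Vanish M N f → Vanish M N (sign s * f)
  Vanish-sign {M} {f = f} zero    p n n<N bad = ≡.trans (*-identityˡ f (M ℕ.+ n)) (p n n<N bad)
  Vanish-sign {M} {f = f} (suc s) p n n<N bad =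
    ≡.trans (sign-* s f (M ℕ.+ n)) (cong ℤ.-_ (Vanish-sign {f = f} s p n n<N bad))

  Vanish-antidiagonal : ∀ {M N} n g → (∀ r s → r ℕ.+ s ≡ n → Vanish M N (g r s)) →
                        Vanish M N (antidiagonal n g)
  Vanish-antidiagonal zero    g p = p 0 0 ≡.refl
  Vanish-antidiagonal (suc n) g p m m<N bad =
    cong₂ ℤ._+_ (p (suc n) 0 (ℕ.+-identityʳ (suc n)) m m<N bad)
                (Vanish-antidiagonal n (λ r s → g r (suc s))
                  (λ r s eq → p r (suc s) (≡.trans (ℕ.+-suc r s) (cong suc eq))) m m<N bad)

  -- Relative to the offset M, the product is zero below degree e, degree e itself has residue 0 or
  -- 1, and from e + 1 to e + a the coefficients of X are those of 1. The bound on N leaves no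
  -- further degree.
  Vanish-monomial : ∀ {M N X} e a → e % 4 < 2 → N ≤ e ℕ.+ suc a → X ≈[ suc a ] 1# →
                    Vanish M N (q ^ (M ℕ.+ e) * X)
  Vanish-monomial {M} {N} {X} e a good N≤ X≈1 n n<N bad with ℕ.<-≤-connex n e
  ... | inj₁ n<e = q^-low (M ℕ.+ e) X (M ℕ.+ n) (ℕ.+-monoʳ-< M n<e)
  ... | inj₂ e≤n with ℕ.m≤n⇒∃[o]m+o≡n e≤n
  ...   | zero  , ≡.refl =
    ⊥-elim (ℕ.<⇒≱ good (subst (λ m → 2 ≤ m % 4) (ℕ.+-identityʳ e) bad))
  ...   | suc p , ≡.refl = begin
    (q ^ (M ℕ.+ e) * X) (M ℕ.+ (e ℕ.+ suc p))    ≡⟨ cong (q ^ (M ℕ.+ e) * X) (ℕ.+-assoc M e (suc p)) ⟨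
    (q ^ (M ℕ.+ e) * X) (M ℕ.+ e ℕ.+ suc p)      ≡⟨ q^-shift (M ℕ.+ e) X (suc p) ⟩
    X (suc p)                                    ≡⟨ X≈1 (suc p) (ℕ.+-cancelˡ-< e (suc p) (suc a) (ℕ.≤-trans n<N N≤)) ⟩
    0ℤ                                           ∎
    where open ≡.≡-Reasoning

  poch-constant : ∀ a b n → a 0 ≡ 0ℤ → poch a b n 0 ≡ 1ℤ
  poch-constant a b zero    a0 = ≡.refl
  poch-constant a b (suc n) a0 = begin
    poch a b n 0 ℤ.* (1ℤ ℤ.- (a 0 ℤ.* (b ^ n) 0 ℤ.+ 0ℤ)) ℤ.+ 0ℤ
      ≡⟨ cong₂ (λ x y → x ℤ.* (1ℤ ℤ.- (y ℤ.* (b ^ n) 0 ℤ.+ 0ℤ)) ℤ.+ 0ℤ) (poch-constant a b n a0) a0 ⟩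
    1ℤ ℤ.* (1ℤ ℤ.- (0ℤ ℤ.* (b ^ n) 0 ℤ.+ 0ℤ)) ℤ.+ 0ℤ
      ≡⟨ cong (λ x → 1ℤ ℤ.* (1ℤ ℤ.- (x ℤ.+ 0ℤ)) ℤ.+ 0ℤ) (ℤ.*-zeroˡ ((b ^ n) 0)) ⟩
    1ℤ ∎
    where open ≡.≡-Reasoning

  module _ (i d : ℕ) .{{_ : NonZero i}} .{{_ : NonZero d}} where
    k : ℕ
    k = i ℕ.+ d

    instance
      k-nonZero : NonZero k
      k-nonZero = ℕ.>-nonZero (ℕ.≤-trans (ℕ.>-nonZero⁻¹ i) (ℕ.m≤m+n i d))

    Q : Series
    Q = q ^ k

    Q-adic : Adic Q
    Q-adic = q^-adic k

    w : ℕ → Series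
    w n = poch Q Q n ⁻¹

    w-inverse : ∀ n → poch Q Q n * w n ≈ 1#
    w-inverse n = ⁻¹-inverse (poch Q Q n) (poch-constant Q Q n Q-constant)
      where
      Q-constant : Q 0 ≡ 0ℤ
      Q-constant = ≡.trans (≡.sym (*-identityʳ Q 0)) (q^-low k 1# 0 (ℕ.>-nonZero⁻¹ k))

    -- The factor of index m is 1 - Q^(m+1), which gives one degree more than `poch-stable`.
    poch-stable-suc : ∀ s t → poch Q Q (s ℕ.+ t) ≈[ suc s ] poch Q Q s
    poch-stable-suc s zero    n n≤s = cong (λ m → poch Q Q m n) (ℕ.+-identityʳ s)
    poch-stable-suc s (suc t) n n≤s = begin
      poch Q Q (s ℕ.+ suc t) n                          ≡⟨ cong (λ m → poch Q Q m n) (ℕ.+-suc s t) ⟩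
      (poch Q Q (s ℕ.+ t) * (1# - Q ^ suc (s ℕ.+ t))) n
        ≡⟨ *-cong[] {poch Q Q (s ℕ.+ t)} {poch Q Q s} {1# - Q ^ suc (s ℕ.+ t)} {1#} (suc s) (poch-stable-suc s t)
             (λ m m<s → ≡.trans
               (cong (λ x → 1# m ℤ.- x) (Q-adic (suc (s ℕ.+ t)) m (ℕ.≤-trans m<s (s≤s (ℕ.m≤m+n s t)))))
               (ℤ.+-identityʳ (1# m)))
             n n≤s ⟩
      (poch Q Q s * 1#) n                               ≡⟨ *-identityʳ (poch Q Q s) n ⟩
      poch Q Q s n                                      ∎
      where open ≡.≡-Reasoning

    poch-w : ∀ {s n} → s ≤ n → poch Q Q n * w s ≈[ suc s ] 1#
    poch-w {s} {n} s≤n with ℕ.m≤n⇒∃[o]m+o≡n s≤n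
    ... | t , ≡.refl =
      ≈[]-trans {poch Q Q (s ℕ.+ t) * w s} {poch Q Q s * w s} (suc s)
        (*-cong[] {poch Q Q (s ℕ.+ t)} {poch Q Q s} {w s} (suc s) (poch-stable-suc s t) (λ _ _ → ≡.refl))
        (≈⇒≈[] (suc s) (w-inverse s))

    poch-w-* : ∀ {a b m n} → a ≤ m → b ≤ n → a ≤ b → poch Q Q m * w a * (poch Q Q n * w b) ≈[ suc a ] 1#
    poch-w-* {a} {b} {m} {n} a≤m b≤n a≤b =
      ≈[]-trans {poch Q Q m * w a * (poch Q Q n * w b)} {1# * 1#} (suc a)
        (*-cong[] {poch Q Q m * w a} {1#} {poch Q Q n * w b} {1#} (suc a) (poch-w a≤m)
                  (≈[]-weaken (s≤s a≤b) (poch-w b≤n)))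
        (≈⇒≈[] (suc a) (*-identityˡ 1#))

    module _ (N : ℕ) where
      open FiniteJacobi q i d N w w-inverse using (monomial; swap; jacobi; term; P; c) public
      M : ℕ
      M = k ℕ.* triangle (suc N) ℕ.+ c ℕ.* N

    unit-factor : ℕ → ℕ → ℕ → Series
    unit-factor N r s = P N N * w r * (P N (suc N ℕ.+ N) * w s)

    monomial-factor : ℕ → ℕ → ℕ → Series
    monomial-factor N r s = q ^ (k ℕ.* triangle s ℕ.+ c N ℕ.* r)

    Vanish-small-r : ∀ N r s e → k ℕ.* triangle s ℕ.+ c N ℕ.* r ≡ M N ℕ.+ e → e % 4 < 2 → N ≤ e ℕ.+ suc r →
                     r ≤ N → s ≤ suc N ℕ.+ N → r ≤ s → Vanish (M N) N (monomial-factor N r s * unit-factor N r s)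
    Vanish-small-r N r s e E≡ good N≤ r≤N s≤ r≤s =
      subst (λ E → Vanish (M N) N (q ^ E * unit-factor N r s)) (≡.sym E≡)
        (Vanish-monomial {M N} {N} {unit-factor N r s} e r good N≤ (poch-w-* {r} {s} r≤N s≤ r≤s))

    -- Now s is the index at most N, so `swap` first pairs `w s` with (Q; Q) of length N and leaves
    -- `w r` to the one of length 2N + 1.
    Vanish-small-s : ∀ N r s e → k ℕ.* triangle s ℕ.+ c N ℕ.* r ≡ M N ℕ.+ e → e % 4 < 2 → N ≤ e ℕ.+ suc s →
                     s ≤ N → r ≤ suc N ℕ.+ N → s ≤ r → Vanish (M N) N (monomial-factor N r s * unit-factor N r s)
    Vanish-small-s N r s e E≡ good N≤ s≤N r≤ s≤r =
      Vanish-cong {M N} {N} {monomial-factor N r s * unit-factor N r s} {monomial-factor N r s * unit-factor N s r}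
        (*-congˡ {monomial-factor N r s} {unit-factor N r s} {unit-factor N s r} (swap N (P N N) (P N (suc N ℕ.+ N)) r s))
        (subst (λ E → Vanish (M N) N (q ^ E * unit-factor N s r)) (≡.sym E≡)
          (Vanish-monomial {M N} {N} {unit-factor N s r} e s good N≤ (poch-w-* {s} {r} s≤N r≤ s≤r)))

    module _ (e-good : ∀ m → (k ℕ.* triangle m ℕ.+ i ℕ.* m) % 4 < 2)
             (e′-good : ∀ m → (k ℕ.* triangle m ℕ.+ d ℕ.* m) % 4 < 2) where

      -- As r + s = 2N + 1, exactly one of r and s is at most N. The Jacobi index s - N - 1 is
      -- nonnegative in `high` and negative in `low`.
      Vanish-factors : ∀ N r s → r ℕ.+ s ≡ suc N ℕ.+ N → Vanish (M N) N (monomial-factor N r s * unit-factor N r s)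
      Vanish-factors N r s eq = [ high , low ]′ (ℕ.<-≤-connex N s)
        where
        r≤ : r ≤ suc N ℕ.+ N
        r≤ = subst (r ≤_) eq (ℕ.m≤m+n r s)
        s≤ : s ≤ suc N ℕ.+ N
        s≤ = subst (s ≤_) eq (ℕ.m≤n+m s r)

        high : N < s → Vanish (M N) N (monomial-factor N r s * unit-factor N r s)
        high N<s =
          Vanish-small-r N r s (k ℕ.* triangle m ℕ.+ i ℕ.* m) (Exponents.exponent-high i d r+m≡N N+m≡s) (e-good m)
            (Exponents.linear-bound k i (ℕ.≤-reflexive (≡.sym r+m≡N))) r≤N s≤ (ℕ.≤-trans r≤N (ℕ.<⇒≤ N<s))
          where
          m : ℕ
          m = s ℕ.∸ suc N
          N+m≡s : suc N ℕ.+ m ≡ s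
          N+m≡s = ℕ.m+[n∸m]≡n N<s
          r+m≡N : r ℕ.+ m ≡ N
          r+m≡N = Exponents.complement-high r m eq N+m≡s
          r≤N : r ≤ N
          r≤N = subst (r ≤_) r+m≡N (ℕ.m≤m+n r m)

        low : s ≤ N → Vanish (M N) N (monomial-factor N r s * unit-factor N r s)
        low s≤N =
          Vanish-small-s N r s (k ℕ.* triangle (suc l) ℕ.+ d ℕ.* suc l)
            (Exponents.exponent-low k d s+l≡N N+l≡r) (e′-good (suc l))
            (Exponents.linear-bound k d (ℕ.≤-trans (ℕ.≤-reflexive (≡.sym s+l≡N)) (ℕ.+-monoʳ-≤ s (ℕ.n≤1+n l)))) s≤N r≤
            (ℕ.≤-trans s≤N (subst (N ≤_) N+l≡r (ℕ.m≤m+n N (suc l))))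
          where
          l : ℕ
          l = N ℕ.∸ s
          s+l≡N : s ℕ.+ l ≡ N
          s+l≡N = ℕ.m+[n∸m]≡n s≤N
          N+l≡r : N ℕ.+ suc l ≡ r
          N+l≡r = Exponents.complement-low s l eq s+l≡N

      Vanish-sum : ∀ N → Vanish (M N) N (q ^ M N * (poch (q ^ i) Q N * poch (q ^ d) Q (suc N) * P N N))
      Vanish-sum N =
        Vanish-cong {M N} {N} {q ^ M N * (poch (q ^ i) Q N * poch (q ^ d) Q (suc N) * P N N)}
          {sign (suc N) * antidiagonal (suc N ℕ.+ N) term′} (jacobi N)
          (Vanish-sign {M N} {N} {antidiagonal (suc N ℕ.+ N) term′} (suc N)
            (Vanish-antidiagonal {M N} {N} (suc N ℕ.+ N) term′ λ r s eq →
              Vanish-cong {M N} {N} {term′ r s} {sign s * (monomial-factor N r s * unit-factor N r s)}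
                (monomial N (P N N) (P N (suc N ℕ.+ N)) r s)
                (Vanish-sign {M N} {N} {monomial-factor N r s * unit-factor N r s} s (Vanish-factors N r s eq))))
        where
        term′ : ℕ → ℕ → Series
        term′ r s = P N N * P N (suc N ℕ.+ N) * term N r s

      -- Modulo q^(n+1) the infinite products become finite ones; multiplying by q^M and reading
      -- degree M + n brings in the finite identity.
      triple-product-support : ∀ n → 2 ≤ n % 4 → ⟨_,_,_⨾_⟩∞ (q D.^ i) (q D.^ d) (q D.^ k) (q D.^ k) n ≡ 0ℤ
      triple-product-support n bad = begin
        ⟨_,_,_⨾_⟩∞ (q D.^ i) (q D.^ d) (q D.^ k) (q D.^ k) n
          ≡⟨ *-cong[] {⟨ q D.^ i ⨾ q D.^ k ⟩∞ * ⟨ q D.^ d ⨾ q D.^ k ⟩∞} {A * B} {⟨ q D.^ k ⨾ q D.^ k ⟩∞} {P N N} N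
               (*-cong[] {⟨ q D.^ i ⨾ q D.^ k ⟩∞} {A} {⟨ q D.^ d ⨾ q D.^ k ⟩∞} {B} N (finite i) B-finite)
               (finite k) n ℕ.≤-refl ⟩
        (A * B * P N N) n
          ≡⟨ q^-shift (M N) (A * B * P N N) n ⟨
        (q ^ M N * (A * B * P N N)) (M N ℕ.+ n)
          ≡⟨ Vanish-sum N n ℕ.≤-refl bad ⟩
        0ℤ ∎
        where
        open ≡.≡-Reasoning
        N : ℕ
        N = suc n
        A B : Series
        A = poch (q ^ i) Q N
        -- One factor more than in `A`, since Rothe's 2N + 1 factors split into N + 1 and N;
        -- `B-finite` absorbs the surplus.
        B = poch (q ^ d) Q (suc N)
        finite : ∀ e → ⟨ q D.^ e ⨾ q D.^ k ⟩∞ ≈[ N ] poch (q ^ e) Q N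
        finite e = ⟨⟩∞≈[]poch N (D^≈^ {q} {q} e (λ _ → ≡.refl)) (D^≈^ {q} {q} k (λ _ → ≡.refl)) Q-adic
        B-finite : ⟨ q D.^ d ⨾ q D.^ k ⟩∞ ≈[ N ] B
        B-finite = ≈[]-trans N (finite d) (≈[]-sym N (poch-stable (q ^ d) Q-adic N 1))

-- Overpartitions modulo 4

module Overpartitions where
  open SeriesRing using (seriesRing; _≈[_]_)
  open CommutativeRing seriesRing
  open import Algebra.Properties.CommutativeSemiring.Exp commutativeSemiring
  open FiniteProducts seriesRing
  open Truncation
  open +-*-Solver using (solve; _:=_; _:+_; _:*_; con)

  E U φ : Series
  E = ⟨ - q ⨾ q ⟩∞
  U = ⟨ q ⨾ q ⟩∞
  φ = ⟨_,_,_⨾_⟩∞ (q D.^ 1) (q D.^ 1) (q D.^ 2) (q D.^ 2)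

  E≈[]poch : ∀ N → E ≈[ N ] poch (- q) q N
  E≈[]poch N = ⟨⟩∞≈[]poch { - q} { - q} {q} {q} N (λ _ → ≡.refl) (λ _ → ≡.refl) q-adic

  U≈[]poch : ∀ N → U ≈[ N ] poch q q N
  U≈[]poch N = ⟨⟩∞≈[]poch {q} {q} {q} {q} N (λ _ → ≡.refl) (λ _ → ≡.refl) q-adic

  -- With A = (q; q²), B = (q²; q²) and C = (-q; q), interleaving gives A B = (q; q), and C (q; q) =
  -- B. Hence A² B C = A (C (A B)) = A B = (q; q). At finite length A B has 2N factors and is cut
  -- back to N modulo q^N.
  φ-* : ∀ N → φ * E ≈[ N ] U
  φ-* N =
    ≈[]-trans {φ * E} {A * A * B * C} N
      (*-cong[] {φ} {A * A * B} {E} {C} N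
        (*-cong[] {⟨ q D.^ 1 ⨾ q D.^ 2 ⟩∞ * ⟨ q D.^ 1 ⨾ q D.^ 2 ⟩∞} {A * A} {⟨ q D.^ 2 ⨾ q D.^ 2 ⟩∞} {B} N
          (*-cong[] {⟨ q D.^ 1 ⨾ q D.^ 2 ⟩∞} {A} {⟨ q D.^ 1 ⨾ q D.^ 2 ⟩∞} {A} N finite₁ finite₁) finite₂)
        (E≈[]poch N))
    (≈[]-trans {A * A * B * C} {A * (C * (A * B))} N (≈⇒≈[] N (rearrange A B C))
    (≈[]-trans {A * (C * (A * B))} {A * (C * poch q q N)} N
      (*-cong[] {A} {A} {C * (A * B)} {C * poch q q N} N (λ _ _ → ≡.refl)
        (*-cong[] {C} {C} {A * B} {poch q q N} N (λ _ _ → ≡.refl) AB≈))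
    (≈[]-trans {A * (C * poch q q N)} {A * B} N
      (≈⇒≈[] N (*-congˡ {A} {C * poch q q N} {B} (poch-neg-* q N)))
    (≈[]-trans {A * B} {poch q q N} {U} N AB≈ (≈[]-sym {U} {poch q q N} N (U≈[]poch N))))))
    where
    A B C : Series
    A = poch q (q ^ 2) N
    B = poch (q ^ 2) (q ^ 2) N
    C = poch (- q) q N
    finite₁ : ⟨ q D.^ 1 ⨾ q D.^ 2 ⟩∞ ≈[ N ] A
    finite₁ = ⟨⟩∞≈[]poch {q D.^ 1} {q} {q D.^ 2} {q ^ 2} N (*-identityʳ q) (D^≈^ {q} {q} 2 (λ _ → ≡.refl)) (q^-adic 2)
    finite₂ : ⟨ q D.^ 2 ⨾ q D.^ 2 ⟩∞ ≈[ N ] B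
    finite₂ = ⟨⟩∞≈[]poch {q D.^ 2} {q ^ 2} {q D.^ 2} {q ^ 2} N
      (D^≈^ {q} {q} 2 (λ _ → ≡.refl)) (D^≈^ {q} {q} 2 (λ _ → ≡.refl)) (q^-adic 2)
    AB≈ : A * B ≈[ N ] poch q q N
    AB≈ = ≈[]-trans {A * B} {poch q q (N ℕ.+ N)} N (≈⇒≈[] N (poch-odd-* q N)) (poch-stable q q-adic N N)

  -- The length n + 1 matches the factors that define coefficient n of `E` and `U`, so the finite
  -- identity can be read degree by degree.
  h : Series
  h n = half-difference q (suc n) n

  E≈U+2h : E ≈ U + (h + h)
  E≈U+2h n = begin
    E n                                                      ≡⟨ E≈[]poch (suc n) n ℕ.≤-refl ⟩
    poch (- q) q (suc n) n                                   ≡⟨ poch-neg-difference q (suc n) n ⟩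
    poch q q (suc n) n ℤ.+ (h n ℤ.+ h n)                     ≡⟨ cong (ℤ._+ (h n ℤ.+ h n)) (U≈[]poch (suc n) n ℕ.≤-refl) ⟨
    U n ℤ.+ (h n ℤ.+ h n)                                    ∎
    where open ≡.≡-Reasoning

  UV≈1 : U * U ⁻¹ ≈ 1#
  UV≈1 = ⁻¹-inverse U (≡.trans (U≈[]poch 1 0 (s≤s z≤n)) (Support.poch-constant q q 1 ≡.refl))

  Supported : Series → Set
  Supported f = ∀ n → 2 ≤ n % 4 → f n ≡ 0ℤ

  -- Two residues from 0 and 1 add up to at most 2, so no pair of surviving degrees has a sum
  -- congruent to 3.
  *-supported : ∀ {f g} → Supported f → Supported g → ∀ n → n % 4 ≡ 3 → (f * g) n ≡ 0ℤ
  *-supported {f} {g} pf pg n n≡3 =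
    ≡.trans (ℤSum.sum-cong-≗ {suc n} {λ j → f (toℕ j) ℤ.* g (n ℕ.∸ toℕ j)} {λ _ → 0ℤ}
              λ j → vanish (toℕ j) (ℕ.s≤s⁻¹ (Fin.toℕ<n j)))
            (ℤSum.sum-replicate-zero (suc n))
    where
    vanish : ∀ j → j ≤ n → f j ℤ.* g (n ℕ.∸ j) ≡ 0ℤ
    vanish j j≤n with ℕ.<-≤-connex (j % 4) 2 | ℕ.<-≤-connex ((n ℕ.∸ j) % 4) 2
    ... | inj₂ bad | _ = ≡.trans (cong (ℤ._* g (n ℕ.∸ j)) (pf j bad)) (ℤ.*-zeroˡ (g (n ℕ.∸ j)))
    ... | inj₁ _ | inj₂ bad = ≡.trans (cong (f j ℤ.*_) (pg (n ℕ.∸ j) bad)) (ℤ.*-zeroʳ (f j))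
    ... | inj₁ j<2 | inj₁ n-j<2 = ⊥-elim (ℕ.<⇒≱ sum<3 (ℕ.≤-reflexive (≡.sym sum≡3)))
      where
      sum<3 : j % 4 ℕ.+ (n ℕ.∸ j) % 4 < 3
      sum<3 = s≤s (ℕ.+-mono-≤ (ℕ.s≤s⁻¹ j<2) (ℕ.s≤s⁻¹ n-j<2))
      sum≡3 : j % 4 ℕ.+ (n ℕ.∸ j) % 4 ≡ 3
      sum≡3 = begin
        j % 4 ℕ.+ (n ℕ.∸ j) % 4             ≡⟨ ℕ.m<n⇒m%n≡m (ℕ.m<n⇒m<1+n sum<3) ⟨
        (j % 4 ℕ.+ (n ℕ.∸ j) % 4) % 4       ≡⟨ ℕ.%-distribˡ-+ j (n ℕ.∸ j) 4 ⟨
        (j ℕ.+ (n ℕ.∸ j)) % 4               ≡⟨ cong (_% 4) (ℕ.m+[n∸m]≡n j≤n) ⟩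
        n % 4                               ≡⟨ n≡3 ⟩
        3                                   ∎
        where open ≡.≡-Reasoning

  -- The constant 2 lives in degree 0, a permitted residue.
  2-supported : ∀ {f} → Supported f → Supported (1# + 1# - f)
  2-supported p zero    ()
  2-supported p (suc n) bad = cong (λ x → 0ℤ ℤ.- x) (p (suc n) bad)

  -- The coefficient is that of (2 - ψ) F plus four times that of `Y`, and the first part vanishes
  -- at residue 3.
  4∣coefficient : ∀ {ψ e u v g F} → ψ * e ≈ u → u * v ≈ 1# → e ≈ u + (g + g) → Supported ψ → Supported F →
                  ∀ n → n % 4 ≡ 3 → ℤ.+ 4 ∣ (e * F * v) n
  4∣coefficient {ψ} {e} {u} {v} {g} {F} ψe≈u uv≈1 e≈u+2g pψ pF n n≡3 = divides (Y n) (begin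
    (e * F * v) n
      ≡⟨ square-inverse-mod-4 {ψ} {e} {u} {v} {g} F ψe≈u uv≈1 e≈u+2g n ⟩
    ((1# + 1# - ψ) * F) n ℤ.+ ((Y n ℤ.+ Y n) ℤ.+ (Y n ℤ.+ Y n))
      ≡⟨ cong (ℤ._+ ((Y n ℤ.+ Y n) ℤ.+ (Y n ℤ.+ Y n))) (*-supported {1# + 1# - ψ} {F} (2-supported {ψ} pψ) pF n n≡3) ⟩
    0ℤ ℤ.+ ((Y n ℤ.+ Y n) ℤ.+ (Y n ℤ.+ Y n))
      ≡⟨ solve 1 (λ y → con 0ℤ :+ ((y :+ y) :+ (y :+ y)) := y :* con (ℤ.+ 4)) ≡.refl (Y n) ⟩
    Y n ℤ.* ℤ.+ 4 ∎)
    where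
    open ≡.≡-Reasoning
    Y : Series
    Y = ψ * (g * v * (g * v)) * F

  -- Both i and d are 1 modulo 4, so the terms of nonnegative and of negative index both fall under
  -- `exponent%4<2`.
  triple-product-supported : ∀ α β → let i = 1 ℕ.+ α ℕ.* 4; d = 1 ℕ.+ β ℕ.* 4 in
    Supported (⟨_,_,_⨾_⟩∞ (q D.^ i) (q D.^ d) (q D.^ (i ℕ.+ d)) (q D.^ (i ℕ.+ d)))
  triple-product-supported α β =
    Support.triple-product-support (1 ℕ.+ α ℕ.* 4) (1 ℕ.+ β ℕ.* 4)
      (Exponents.exponent%4<2 α β α) (Exponents.exponent%4<2 α β β)

-- The congruence for `S`

open import Defs using (S)
open import Data.Nat using (_+_; _*_)

residue-form : ∀ m r → m % 4 ≡ r → m ≡ r + m ℕ./ 4 * 4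
residue-form m r eq = ≡.trans (ℕ.m≡m%n+[m/n]*n m 4) (cong (_+ m ℕ./ 4 * 4) eq)

module _ where
  open Overpartitions

  -- The case i = d = 1, k = 2.
  φ-supported : Supported φ
  φ-supported = triple-product-supported 0 0

  4∣S : ∀ i d → Supported (⟨_,_,_⨾_⟩∞ (q D.^ i) (q D.^ d) (q D.^ (i + d)) (q D.^ (i + d))) →
        ∀ n → n % 4 ≡ 3 → + 4 ∣ S (i + d) i n
  4∣S i d supported n n≡3 =
    4∣coefficient {φ} {⟨ D.- q ⨾ q ⟩∞} {⟨ q ⨾ q ⟩∞} {⟨ q ⨾ q ⟩∞ ⁻¹} {h}
      {⟨_,_,_⨾_⟩∞ (q D.^ i) (q D.^ (i + d ℕ.∸ i)) (q D.^ (i + d)) (q D.^ (i + d))}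
      (λ m → φ-* (suc m) m ℕ.≤-refl) UV≈1 E≈U+2h φ-supported
      -- In `S` the second base has exponent `i + d ∸ i`, which has to be turned into `d`.
      (subst (λ e → Supported (⟨_,_,_⨾_⟩∞ (q D.^ i) (q D.^ e) (q D.^ (i + d)) (q D.^ (i + d))))
        (≡.sym (ℕ.m+n∸m≡n i d)) supported)
      n n≡3

4n+3%4≡3 : ∀ n → (4 * n + 3) % 4 ≡ 3
4n+3%4≡3 n =
  ≡.trans (cong (_% 4) (≡.trans (ℕ.+-comm (4 * n) 3) (cong (3 ℕ.+_) (ℕ.*-comm 4 n)))) (ℕ.[m+kn]%n≡m%n 3 n 4)

mainTheorem5 : (k i : ℕ) → 1 ≤ i → 2 * i ≤ k → k % 4 ≡ 2 → i % 4 ≡ 1 →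
               (n : ℕ) → + 4 ∣ S k i (4 * n + 3)
mainTheorem5 k i _ 2i≤k k≡2 i≡1 n =
  ≡.subst₂ (λ k i → + 4 ∣ S k i (4 * n + 3)) (≡.sym k≡) (≡.sym (residue-form i 1 i≡1))
    (4∣S (1 + α * 4) (1 + β * 4) (Overpartitions.triple-product-supported α β) (4 * n + 3) (4n+3%4≡3 n))
  where
  α β : ℕ
  α = i ℕ./ 4
  -- From k = 2 + 4κ and i = 1 + 4α follows k - i = 1 + 4 (κ - α); the subtraction is exact because
  -- i ≤ k gives α ≤ κ.
  β = k ℕ./ 4 ℕ.∸ α
  α≤ : α ≤ k ℕ./ 4
  α≤ = ℕ./-monoˡ-≤ 4 (ℕ.≤-trans (ℕ.m≤m+n i (i + 0)) 2i≤k)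
  k≡ : k ≡ 1 + α * 4 + (1 + β * 4)
  k≡ = begin
    k                                  ≡⟨ residue-form k 2 k≡2 ⟩
    2 + k ℕ./ 4 * 4                    ≡⟨ cong (λ x → 2 + x * 4) (ℕ.m+[n∸m]≡n α≤) ⟨
    2 + (α + β) * 4                    ≡⟨ cong (2 ℕ.+_) (ℕ.*-distribʳ-+ 4 α β) ⟩
    2 + (α * 4 + β * 4)                ≡⟨ cong suc (ℕ.+-suc (α * 4) (β * 4)) ⟨
    1 + α * 4 + (1 + β * 4)            ∎
    where open ≡.≡-Reasoning
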